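{- Let $\mathcal{G}=(G,\lambda)$ be a temporal graph, where $G$ is either an undirected graph or a directed graph, and let $s,t\in V(G)$ be non-adjacent. (1) $tp(s,t)=1$ if and only if $tpc(s,t)=1$. (2) For each fixed integer $k\ge 2$ there exists a temporal graph $\mathcal{G}=(G,\lambda)$ (and also one whose underlying graph is directed) and non-adjacent $s,t\in V(G)$ such that $tpc(s,t)=k+tp(s,t)$.
   Context: A temporal graph with lifetime $\tau$ is a pair $(G,\lambda)$ where $G$ is a finite simple (undirected or directed) graph and $\lambda$ assigns to each edge (arc) a subset of $[\tau]=\{1,\dots,\tau\}$. A temporal vertex is an element of $V(G)\times[\tau]$. A (non-strict) temporal $s,t$-walk is a sequence $(s=v_1,t_1,v_2,t_2,\dots,t_{p-1},v_p=t)$ such that $v_iv_{i+1}\in E(G)$ (the arc $(v_i,v_{i+1})$ in the directed case), $t_i\in\lambda(v_iv_{i+1})$ for all $i<p$, and $t_1\le t_2\le\dots\le t_{p-1}$; it is a temporal $s,t$-path if $v_1,\dots,v_p$ are pairwise distinct. The set $V^T(P)$ of temporal vertices contained in such a $P$ consists of $(s,t_1)$, $(t,t_{p-1})$, and, for each $2\le i\le p-1$, all $(v_i,j)$ with $t_{i-1}\le j\le t_i$. Two temporal $s,t$-paths $P,Q$ are t-vertex disjoint if $V^T(P)\cap V^T(Q)\subseteq\{s,t\}\times[\tau]$. A t-vertex $s,t$-cut is a set $S\subseteq (V(G)\setminus\{s,t\})\times[\tau]$ with $S\cap V^T(P)\neq\emptyset$ for every temporal $s,t$-path $P$. $tp(s,t)$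 denotes the maximum number of pairwise t-vertex disjoint temporal $s,t$-paths, and $tpc(s,t)$ the minimum size of a t-vertex $s,t$-cut. -}

module Defs where

open import Data.Nat using (ℕ; zero; suc; _+_)
import Data.Nat as ℕ
open import Data.Fin using (Fin; zero; suc; inject₁; fromℕ)
import Data.Fin as F
open import Data.Bool using (Bool; true; false)
open import Data.Product using (Σ; ∃; ∃-syntax; _×_; _,_)
open import Data.Sum using (_⊎_)
open import Data.List using (List; length)
open import Data.List.Membership.Propositional using (_∈_)
open import Data.List.Relation.Unary.Unique.Propositional using (Unique)
open import Relation.Binary.PropositionalEquality using (_≡_; _≢_)
open import Relation.Nullary using (¬_)
open import Function using (_∘_)
open import Function.Definitions using (Injective)

-- A temporal graph (G, λ).  Vertices are Fin n, time labels are Fin τ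
-- (Fin τ ≅ [τ] = {1,…,τ}, ordered by toℕ).  'adj u v ≡ true' means the
-- arc (u,v) (resp. the edge uv) is present; simple = loopless, and (as a
-- relation) there are no multi-edges.  'lam u v' is the label set of uv.
record TGraph : Set where
  field
    n      : ℕ
    τ      : ℕ
    adj    : Fin n → Fin n → Bool
    noLoop : ∀ v → adj v v ≡ false
    lam    : Fin n → Fin n → Fin τ → Bool

open TGraph public

Undirected : TGraph → Set
Undirected G = (∀ u v → adj G u v ≡ adj G v u) × (∀ u v → lam G u v ≡ lam G v u)

NonAdjacent : (G : TGraph) → Fin (n G) → Fin (n G) → Set
NonAdjacent G s t = (adj G s t ≡ false) × (adj G t s ≡ false)

-- For a path with vertices v_1 … v_p (p = ℓ + 2) and times t_1 … t_{p-1}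
-- (indexed from 0), 'lo k' / 'hi k' give the time interval of the
-- temporal vertices of v_k contained in the path:
-- first vertex: [t_1,t_1]; last vertex: [t_{p-1},t_{p-1}];
-- inner vertex v_i: [t_{i-1}, t_i].
lo : ∀ {A : Set} {ℓ} → (Fin (suc ℓ) → A) → Fin (suc (suc ℓ)) → A
lo f zero    = f zero
lo f (suc i) = f i

hi : ∀ {A : Set} {ℓ} → (Fin (suc ℓ) → A) → Fin (suc (suc ℓ)) → A
hi f zero = f zero
hi {ℓ = zero}  f (suc zero) = f zero
hi {ℓ = suc ℓ} f (suc k)    = hi {ℓ = ℓ} (f ∘ suc) k

-- A temporal s,t-path (non-strict).  Since s ≠ t, every s,t-path has
-- p ≥ 2 vertices; here p = ℓ + 2 and there are ℓ + 1 time labels.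
record TPath (G : TGraph) (s t : Fin (n G)) : Set where
  field
    ℓ        : ℕ
    vert     : Fin (suc (suc ℓ)) → Fin (n G)
    time     : Fin (suc ℓ) → Fin (τ G)
    start    : vert zero ≡ s
    end      : vert (fromℕ (suc ℓ)) ≡ t
    distinct : Injective _≡_ _≡_ vert
    arc      : ∀ i → adj G (vert (inject₁ i)) (vert (suc i)) ≡ true
    avail    : ∀ i → lam G (vert (inject₁ i)) (vert (suc i)) (time i) ≡ true
    mono     : ∀ i j → i F.≤ j → time i F.≤ time j

open TPath public

TVertex : TGraph → Set
TVertex G = Fin (n G) × Fin (τ G)

InVT : ∀ {G s t} → TVertex G → TPath G s t → Set
InVT (v , j) P = ∃[ k ] (vert P k ≡ v × lo (time P) k F.≤ j × j F.≤ hi (time P) k)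

TDisjoint : ∀ {G s t} → TPath G s t → TPath G s t → Set
TDisjoint {s = s} {t = t} P Q =
  ∀ v j → InVT (v , j) P → InVT (v , j) Q → v ≡ s ⊎ v ≡ t

-- t-vertex s,t-cut, given as a duplicate-free list (so its length is its size).
IsTCut : (G : TGraph) (s t : Fin (n G)) → List (TVertex G) → Set
IsTCut G s t S =
  Unique S
  × (∀ v j → (v , j) ∈ S → v ≢ s × v ≢ t)
  × (∀ (P : TPath G s t) → ∃[ x ] (x ∈ S × InVT x P))

DisjointFamily : (G : TGraph) (s t : Fin (n G)) (k : ℕ) → (Fin k → TPath G s t) → Set
DisjointFamily G s t k P = ∀ i j → i ≢ j → TDisjoint (P i) (P j)

TP≡ : (G : TGraph) (s t : Fin (n G)) → ℕ → Set
TP≡ G s t k =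
  (Σ (Fin k → TPath G s t) (DisjointFamily G s t k))
  × (∀ m (P : Fin m → TPath G s t) → DisjointFamily G s t m P → m ℕ.≤ k)

TPC≡ : (G : TGraph) (s t : Fin (n G)) → ℕ → Set
TPC≡ G s t k =
  (Σ (List (TVertex G)) λ S → IsTCut G s t S × length S ≡ k)
  × (∀ S → IsTCut G s t S → k ℕ.≤ length S)

{-# OPTIONS --safe #-}

-- Part (1).  A walk of the static expansion shortcuts, by waiting at revisited vertices, to a path
-- inside its closure (all times between two visits of the same vertex), so it suffices to find
-- either a point in the closure of every walk or two walks with disjoint closures.  This goes by
-- induction on the number of temporal edges.  Deleting an edge e = (x , y , i) leaves a cut
-- z = (v , j).  As in Göring's proof of Menger's theorem, join two disjoint walks ending in z and
-- (x , i) to two disjoint walks starting in z and (y , i).  The closures of the results can only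
-- clash if the walk through e passes v both before and after e.  To prevent this, one of the two
-- halves is solved without the edges leaving (entering) v.  If that fails for both halves, every
-- walk through e can bypass e by waiting at v, so z already is a cut.
--
-- Part (2).  A gadget with tp = 2 and tpc = 3 is glued k times at s and t.
module Submission where

open import Defs
open import Data.Bool using (Bool; true; false; _∨_; _∧_)
import Data.Bool.Properties as 𝔹
open import Data.Empty using (⊥; ⊥-elim)
open import Data.Fin using (Fin; zero; suc; inject₁; fromℕ; combine; remQuot; quotient; remainder)
import Data.Fin as F
open import Data.Fin.Patterns
import Data.Fin.Properties as Fₚ
open import Data.List using (List; []; _∷_; length; map; filter; cartesianProduct; allFin; tabulate)
import Data.List as L
open import Data.List.Membership.Propositional using (_∈_; lose; find)
open import Data.List.Membership.Propositional.Properties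
  using (∈-map⁺; ∈-map⁻; ∈-filter⁺; ∈-filter⁻; ∈-cartesianProduct⁺; ∈-cartesianProduct⁻; ∈-allFin;
         ∈-tabulate⁺; ∈-tabulate⁻)
open import Data.List.Properties using (length-filter; length-tabulate)
open import Data.List.Relation.Unary.All using ([])
open import Data.List.Relation.Unary.AllPairs using ([]; _∷_)
open import Data.List.Relation.Unary.Any using (Any; here; there; any?; index)
open import Data.List.Relation.Unary.Any.Properties using (lookup-index)
open import Data.List.Relation.Unary.Unique.Propositional.Properties using (tabulate⁺)
open import Data.Nat using (ℕ; zero; suc; _+_; _*_; _≤_; z≤n; s≤s)
import Data.Nat as ℕ
import Data.Nat.Properties as ℕₚ
open import Data.Product using (Σ; ∃-syntax; _×_; _,_; proj₁; proj₂)
open import Data.Product.Properties using (,-injective) renaming (≡-dec to ×-≡-dec)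
open import Data.Sum using (_⊎_; inj₁; inj₂; [_,_]′)
open import Data.Vec using (Vec; []; _∷_; lookup; replicate; zipWith)
open import Data.Vec.Properties using (zipWith-comm)
open import Function using (id; _∘_; Injective; mk⇔)
open import Function.Bundles using (_⇔_)
open import Level using (0ℓ)
open import Relation.Binary using (DecidableEquality; Reflexive; Transitive; Total; Rel)
import Relation.Binary as B
open import Relation.Binary.PropositionalEquality using (_≡_; _≢_; refl; sym; trans; subst; subst₂; cong; cong₂)
open import Relation.Nullary using (¬_; Dec; yes; no; does; ¬?; _×-dec_; _→-dec_; contradiction)
open import Relation.Nullary.Decidable using (from-yes; dec-true; map′; True; toWitness; _⊎-dec_)
open import Relation.Unary using (Pred; _⊆_; _∪_; _∩_; Decidable; U)

-- Walks in the static expansion, their closures, cuts and disjoint pairs.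

module Menger {V T : Set} (_≟_ : DecidableEquality V) (_≤_ : Rel T 0ℓ)
  (≤-refl : Reflexive _≤_) (≤-trans : Transitive _≤_) (≤-total : Total _≤_)
  (_≤?_ : B.Decidable _≤_) where

  Point : Set
  Point = V × T

  Hop : Set
  Hop = V × V × T

  -- `S` is required only at the points where the walk starts, ends or changes its vertex or time.
  -- The times passed while waiting are recovered by `Cl`.
  data Reach (E : List Hop) (S : Pred Point 0ℓ) : Point → Point → Set where
    done : ∀ {p} → S p → Reach E S p p
    wait : ∀ {v a b q} → S (v , a) → a ≤ b → Reach E S (v , b) q → Reach E S (v , a) q
    hop  : ∀ {x y i q} → S (x , i) → (x , y , i) ∈ E → Reach E S (y , i) q → Reach E S (x , i) q

  -- A path that shortcuts a walk through S by waiting at revisited vertices stays inside Cl S.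
  record Cl (S : Pred Point 0ℓ) (x : Point) : Set where
    constructor _⟨_⟩_
    field
      {a b}  : T
      start∈ : S (proj₁ x , a)
      within : a ≤ proj₂ x × proj₂ x ≤ b
      end∈   : S (proj₁ x , b)

  Walk : List Hop → Pred Point 0ℓ → List Point → List Point → Set
  Walk E S A B = ∃[ p ] ∃[ q ] p ∈ A × q ∈ B × Reach E S p q

  -- Quantifying over all `S` that carry a walk replaces a quantification over walks; the strongest
  -- instance takes for `S` the points `On` the walk.
  Cut : List Hop → List Point → List Point → Point → Set₁
  Cut E A B z = ∀ {S} → Walk E S A B → Cl S z

  ClDisjoint : (S S′ : Pred Point 0ℓ) → Set
  ClDisjoint S S′ = ∀ x → Cl S x → Cl S′ x → ⊥

  record TwoDisjoint (E : List Hop) (A B : List Point) : Set₁ where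
    constructor two
    field
      {S₁ S₂}  : Pred Point 0ℓ
      walk₁    : Walk E S₁ A B
      walk₂    : Walk E S₂ A B
      disjoint : ClDisjoint S₁ S₂

  CutOrTwo : List Hop → List Point → List Point → Set₁
  CutOrTwo E A B = (∃[ z ] Cut E A B z) ⊎ TwoDisjoint E A B

  record Fan (E : List Hop) (A : List Point) (q₁ q₂ : Point) : Set₁ where
    constructor fan
    field
      {S₁ S₂}  : Pred Point 0ℓ
      {p₁ p₂}  : Point
      p₁∈      : p₁ ∈ A
      p₂∈      : p₂ ∈ A
      walk₁    : Reach E S₁ p₁ q₁
      walk₂    : Reach E S₂ p₂ q₂
      disjoint : ClDisjoint S₁ S₂

  record CoFan (E : List Hop) (p₁ p₂ : Point) (B : List Point) : Set₁ where
    constructor coFan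
    field
      {S₁ S₂}  : Pred Point 0ℓ
      {q₁ q₂}  : Point
      q₁∈      : q₁ ∈ B
      q₂∈      : q₂ ∈ B
      walk₁    : Reach E S₁ p₁ q₁
      walk₂    : Reach E S₂ p₂ q₂
      disjoint : ClDisjoint S₁ S₂

  private
    variable
      E E′ : List Hop
      S S′ : Pred Point 0ℓ
      p q r : Point
      u v : V
      a b : T
      A B : List Point

  -- Points on a walk; cutting and joining walks.

  Away : V → Pred Point 0ℓ
  Away v (u , _) = u ≢ v

  -- The least predicate carrying the walk. Unlike those of an arbitrary `S`, its points lie in time
  -- between the two ends, and the walk can be cut at each of them.
  On : Reach E S p q → Pred Point 0ℓ
  On (done {p} _)            q = q ≡ p
  On (wait {v} {a} _ _ w)    q = q ≡ (v , a) ⊎ On w q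
  On (hop {x} {i = i} _ _ w) q = q ≡ (x , i) ⊎ On w q

  on-start : (w : Reach E S p q) → On w p
  on-start (done _)     = refl
  on-start (wait _ _ _) = inj₁ refl
  on-start (hop _ _ _)  = inj₁ refl

  on-end : (w : Reach E S p q) → On w q
  on-end (done _)     = refl
  on-end (wait _ _ w) = inj₂ (on-end w)
  on-end (hop _ _ w)  = inj₂ (on-end w)

  on⇒ : (w : Reach E S p q) → On w ⊆ S
  on⇒ (done s)     refl        = s
  on⇒ (wait s _ w) (inj₁ refl) = s
  on⇒ (wait s _ w) (inj₂ o)    = on⇒ w o
  on⇒ (hop s _ w)  (inj₁ refl) = s
  on⇒ (hop s _ w)  (inj₂ o)    = on⇒ w o

  start∈ : Reach E S p q → S p
  start∈ w = on⇒ w (on-start w)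

  end∈ : Reach E S p q → S q
  end∈ w = on⇒ w (on-end w)

  map-reach : (∀ {h} → h ∈ E → h ∈ E′) → S ⊆ S′ → Reach E S p q → Reach E′ S′ p q
  map-reach f g (done s)     = done (g s)
  map-reach f g (wait s l w) = wait (g s) l (map-reach f g w)
  map-reach f g (hop s e w)  = hop (g s) (f e) (map-reach f g w)

  widen : S ⊆ S′ → Reach E S p q → Reach E S′ p q
  widen = map-reach id

  tighten : (w : Reach E S p q) → Reach E (On w) p q
  tighten (done s)     = done refl
  tighten (wait s l w) = wait (inj₁ refl) l (widen inj₂ (tighten w))
  tighten (hop s e w)  = hop (inj₁ refl) e (widen inj₂ (tighten w))

  infixr 5 _++_
  _++_ : Reach E S p q → Reach E S q r → Reach E S p r
  done _     ++ w′ = w′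
  wait s l w ++ w′ = wait s l (w ++ w′)
  hop s e w  ++ w′ = hop s e (w ++ w′)

  prefix : (w : Reach E S p q) → ∀ {x} → On w x → Reach E (On w) p x
  prefix (done s)     refl        = done refl
  prefix (wait s l w) (inj₁ refl) = done (inj₁ refl)
  prefix (wait s l w) (inj₂ o)    = wait (inj₁ refl) l (widen inj₂ (prefix w o))
  prefix (hop s e w)  (inj₁ refl) = done (inj₁ refl)
  prefix (hop s e w)  (inj₂ o)    = hop (inj₁ refl) e (widen inj₂ (prefix w o))

  suffix : (w : Reach E S p q) → ∀ {x} → On w x → Reach E (On w) x q
  suffix (done s)       refl        = done refl
  suffix w@(wait _ _ _) (inj₁ refl) = tighten w
  suffix (wait s l w)   (inj₂ o)    = widen inj₂ (suffix w o)
  suffix w@(hop _ _ _)  (inj₁ refl) = tighten w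
  suffix (hop s e w)    (inj₂ o)    = widen inj₂ (suffix w o)

  monotone : Reach E S p q → proj₂ p ≤ proj₂ q
  monotone (done _)     = ≤-refl
  monotone (wait _ l w) = ≤-trans l (monotone w)
  monotone (hop _ _ w)  = monotone w

  on-early : (w : Reach E S p q) → ∀ {x} → On w x → proj₂ x ≤ proj₂ q
  on-early w o = monotone (suffix w o)

  on-late : (w : Reach E S p q) → ∀ {x} → On w x → proj₂ p ≤ proj₂ x
  on-late w o = monotone (prefix w o)

  -- The closure operator, and fans from disjoint pairs.

  cl-unit : S ⊆ Cl S
  cl-unit s = s ⟨ ≤-refl , ≤-refl ⟩ s

  cl-map : S ⊆ S′ → Cl S ⊆ Cl S′
  cl-map f (s ⟨ l ⟩ s′) = f s ⟨ l ⟩ f s′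

  cl-idem : Cl (Cl S) ⊆ Cl S
  cl-idem ((s ⟨ l , _ ⟩ _) ⟨ m , m′ ⟩ (_ ⟨ _ , l′ ⟩ s′)) = s ⟨ ≤-trans l m , ≤-trans m′ l′ ⟩ s′

  cl-away : ¬ Cl (Away v) (v , b)
  cl-away (s ⟨ _ ⟩ _) = s refl

  -- A closure point at `v` depends only on the points at `v`, and `S` contributes none.
  cl-∪ʳ : (∀ {k} → ¬ S (v , k)) → Cl (S ∪ S′) (v , b) → Cl S′ (v , b)
  cl-∪ʳ n (inj₂ s ⟨ l ⟩ inj₂ s′) = s ⟨ l ⟩ s′
  cl-∪ʳ n (inj₁ s ⟨ _ ⟩ _)      = ⊥-elim (n s)
  cl-∪ʳ n (_ ⟨ _ ⟩ inj₁ s)      = ⊥-elim (n s)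

  cl-∪ˡ : (∀ {k} → ¬ S′ (v , k)) → Cl (S ∪ S′) (v , b) → Cl S (v , b)
  cl-∪ˡ n (inj₁ s ⟨ l ⟩ inj₁ s′) = s ⟨ l ⟩ s′
  cl-∪ˡ n (inj₂ s ⟨ _ ⟩ _)      = ⊥-elim (n s)
  cl-∪ˡ n (_ ⟨ _ ⟩ inj₂ s)      = ⊥-elim (n s)

  -- A target reached by both walks would lie in both closures, so the walks end in different
  -- targets.
  toFan : TwoDisjoint E A (p ∷ q ∷ []) → Fan E A p q
  toFan (two (_ , _ , a , here refl , w) (_ , _ , b , here refl , w′) d) =
    ⊥-elim (d _ (cl-unit (end∈ w)) (cl-unit (end∈ w′)))
  toFan (two (_ , _ , a , there (here refl) , w) (_ , _ , b , there (here refl) , w′) d) =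
    ⊥-elim (d _ (cl-unit (end∈ w)) (cl-unit (end∈ w′)))
  toFan (two (_ , _ , a , here refl , w) (_ , _ , b , there (here refl) , w′) d) = fan a b w w′ d
  toFan (two (_ , _ , a , there (here refl) , w) (_ , _ , b , here refl , w′) d) =
    fan b a w′ w (λ x c c′ → d x c′ c)

  toCoFan : TwoDisjoint E (p ∷ q ∷ []) B → CoFan E p q B
  toCoFan (two (_ , _ , here refl , a , w) (_ , _ , here refl , b , w′) d) =
    ⊥-elim (d _ (cl-unit (start∈ w)) (cl-unit (start∈ w′)))
  toCoFan (two (_ , _ , there (here refl) , a , w) (_ , _ , there (here refl) , b , w′) d) =
    ⊥-elim (d _ (cl-unit (start∈ w)) (cl-unit (start∈ w′)))
  toCoFan (two (_ , _ , here refl , a , w) (_ , _ , there (here refl) , b , w′) d) = coFan a b w w′ d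
  toCoFan (two (_ , _ , there (here refl) , a , w) (_ , _ , here refl , b , w′) d) =
    coFan b a w′ w (λ x c c′ → d x c′ c)

  -- Deleting the edges that leave or enter a vertex.

  abstract
    noExit noEntry : V → List Hop → List Hop
    noExit v  = filter (λ h → ¬? (proj₁ h ≟ v))
    noEntry v = filter (λ h → ¬? (proj₁ (proj₂ h) ≟ v))

    length-noExit : ∀ v E → length (noExit v E) ℕ.≤ length E
    length-noExit v = length-filter _

    length-noEntry : ∀ v E → length (noEntry v E) ℕ.≤ length E
    length-noEntry v = length-filter _

    ∈-noExit⁻ : (u , p) ∈ noExit v E → (u , p) ∈ E × u ≢ v
    ∈-noExit⁻ {v = v} = ∈-filter⁻ (λ h → ¬? (proj₁ h ≟ v))

    ∈-noEntry⁻ : ∀ {y i} → (u , y , i) ∈ noEntry v E → (u , y , i) ∈ E × y ≢ v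
    ∈-noEntry⁻ {v = v} = ∈-filter⁻ (λ h → ¬? (proj₁ (proj₂ h) ≟ v))

    ∈-noExit⁺ : (u , p) ∈ E → u ≢ v → (u , p) ∈ noExit v E
    ∈-noExit⁺ {v = v} = ∈-filter⁺ (λ h → ¬? (proj₁ h ≟ v))

    ∈-noEntry⁺ : ∀ {y i} → (u , y , i) ∈ E → y ≢ v → (u , y , i) ∈ noEntry v E
    ∈-noEntry⁺ {v = v} = ∈-filter⁺ (λ h → ¬? (proj₁ (proj₂ h) ≟ v))

  noExit⊆ : ∀ {h} → h ∈ noExit v E → h ∈ E
  noExit⊆ = proj₁ ∘ ∈-noExit⁻

  noEntry⊆ : ∀ {h} → h ∈ noEntry v E → h ∈ E
  noEntry⊆ = proj₁ ∘ ∈-noEntry⁻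

  -- Without edges out of `v`, a walk that reaches `v` remains there until its end.
  noExit⇒away : u ≢ v → Reach (noExit v E) S p (u , a) → Reach (noExit v E) (S ∩ Away v) p (u , a)
  noExit⇒away n (done s) = done (s , n)
  noExit⇒away n (wait s l w) with noExit⇒away n w
  ... | w′ = wait (s , proj₂ (start∈ w′)) l w′
  noExit⇒away {v = v} n (hop s e w) =
    hop (s , proj₂ (∈-noExit⁻ e)) e (noExit⇒away n w)

  noEntry⇒away : u ≢ v → Reach (noEntry v E) S (u , a) q → Reach (noEntry v E) (S ∩ Away v) (u , a) q
  noEntry⇒away n (done s)     = done (s , n)
  noEntry⇒away n (wait s l w) = wait (s , n) l (noEntry⇒away n w)
  noEntry⇒away {v = v} n (hop s e w) =
    hop (s , n) e (noEntry⇒away (proj₂ (∈-noEntry⁻ e)) w)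

  -- Up to its first visit of `v` a walk uses no edge out of `v`, so this part survives the deletion
  -- of those edges.
  firstVisit : ∀ v → Reach E S p q →
    Reach (noExit v E) (S ∩ Away v) p q ⊎ (∃[ a ] a ≤ proj₂ q × Reach (noExit v E) S p (v , a))
  firstVisit {p = x , i} v w with x ≟ v
  firstVisit v w            | yes refl = inj₂ (_ , monotone w , done (start∈ w))
  firstVisit v (done s)     | no n = inj₁ (done (s , n))
  firstVisit v (wait s l w) | no n with firstVisit v w
  ... | inj₁ w′           = inj₁ (wait (s , n) l w′)
  ... | inj₂ (a , m , w′) = inj₂ (a , m , wait s l w′)
  firstVisit v (hop s e w)  | no n with firstVisit v w | ∈-noExit⁺ e n
  ... | inj₁ w′           | e′ = inj₁ (hop (s , n) e′ w′)
  ... | inj₂ (a , m , w′) | e′ = inj₂ (a , m , hop s e′ w′)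

  -- The time reversal of `firstVisit`: from its last point at `v` on, a walk uses no edge into `v`.
  lastVisit : ∀ v → Reach E S p q →
    Reach (noEntry v E) (S ∩ Away v) p q ⊎ (∃[ b ] proj₂ p ≤ b × Reach (noEntry v E) S (v , b) q)
  lastVisit {p = x , i} v (done s) with x ≟ v
  ... | yes refl = inj₂ (i , ≤-refl , done s)
  ... | no n     = inj₁ (done (s , n))
  lastVisit v (wait s l w) with lastVisit v w
  ... | inj₁ w′           = inj₁ (wait (s , proj₂ (start∈ w′)) l w′)
  ... | inj₂ (b , m , w′) = inj₂ (b , ≤-trans l m , w′)
  lastVisit {p = x , i} v (hop s e w) with lastVisit v w
  ... | inj₂ (b , m , w′) = inj₂ (b , m , w′)
  ... | inj₁ w′ with x ≟ v | ∈-noEntry⁺ e (proj₂ (start∈ w′))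
  ...   | yes refl | e′ = inj₂ (i , ≤-refl , hop s e′ (widen proj₁ w′))
  ...   | no n     | e′ = inj₁ (hop (s , n) e′ w′)

  -- If the edge is used, the part before its first use and the part after its last use are kept;
  -- both avoid the edge.
  splitAtHop : ∀ {x y i} → Reach ((x , y , i) ∷ E) S p q →
    Reach E S p q ⊎ (Reach E S p (x , i) × Reach E S (y , i) q)
  splitAtHop (done s) = inj₁ (done s)
  splitAtHop (wait s l w) with splitAtHop w
  ... | inj₁ w′       = inj₁ (wait s l w′)
  ... | inj₂ (w₁ , w₂) = inj₂ (wait s l w₁ , w₂)
  splitAtHop (hop s (here refl) w) with splitAtHop w
  ... | inj₁ w′       = inj₂ (done s , w′)
  ... | inj₂ (_ , w₂) = inj₂ (done s , w₂)
  splitAtHop (hop s (there e) w) with splitAtHop w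
  ... | inj₁ w′       = inj₁ (hop s e w′)
  ... | inj₂ (w₁ , w₂) = inj₂ (hop s e w₁ , w₂)

  -- The induction step: adding an edge to a graph with a cut point.

  module Step (E : List Hop) (A B : List Point) (v : V) (j : T) (x y : V) (i : T)
    (cut : Cut E A B (v , j)) where

    z : Point
    z = v , j

    E⁺ : List Hop
    E⁺ = (x , y , i) ∷ E

    -- Two walks that visit `u` in the right order recombine, by waiting at `u`, to a walk without
    -- the new edge, and the cut point is unavoidable for it. The clashes below are refuted this
    -- way.
    glued∋z : ∀ {k l} → p ∈ A → Reach E S p (u , k) → k ≤ l → Reach E S′ (u , l) q → q ∈ B →
      Cl (S ∪ S′) z
    glued∋z p∈ w k≤l w′ q∈ =
      cut (_ , _ , p∈ , q∈ , widen inj₁ w ++ wait (inj₁ (end∈ w)) k≤l (widen inj₂ w′))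

    -- Stop at a visit of `v` no later than `j` and wait for `z`. The waiting lies in the closure
    -- but not necessarily in `S`, whence `Cl S` in the result.
    toCut : Walk E S A B → ∃[ p ] p ∈ A × Reach E (Cl S) p z
    toCut (p , q , p∈ , q∈ , w) with cut (p , q , p∈ , q∈ , tighten w)
    ... | c@(o ⟨ l , _ ⟩ _) = p , p∈ ,
      widen (cl-unit ∘ on⇒ w) (prefix w o) ++ wait (cl-unit (on⇒ w o)) l (done (cl-map (on⇒ w) c))

    fromCut : Walk E S A B → ∃[ q ] q ∈ B × Reach E (Cl S) z q
    fromCut (p , q , p∈ , q∈ , w) with cut (p , q , p∈ , q∈ , tighten w)
    ... | c@(_ ⟨ _ , l ⟩ o) = q , q∈ ,
      wait (cl-map (on⇒ w) c) l (widen (cl-unit ∘ on⇒ w) (suffix w o))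

    -- Stop at the first visit of `v` and wait there until time `j`.
    enterOnce : Reach E S p z → Reach (noExit v E) S p z
    enterOnce w with firstVisit v w
    ... | inj₁ w′ = ⊥-elim (proj₂ (end∈ w′) refl)
    ... | inj₂ (_ , l , w′) = w′ ++ wait (end∈ w′) l (done (end∈ w))

    exitOnce : Reach E S z q → Reach (noEntry v E) S z q
    exitOnce w with lastVisit v w
    ... | inj₁ w′ = ⊥-elim (proj₂ (start∈ w′) refl)
    ... | inj₂ (_ , l , w′) = wait (start∈ w) l w′

    Cutᴱ⁺ : Set₁
    Cutᴱ⁺ = ∃[ w ] Cut E⁺ A B w

    record LeftPair : Set₁ where
      field
        {S₁ S₂}  : Pred Point 0ℓ
        {p₁ p₂}  : Point
        p₁∈      : p₁ ∈ A
        p₂∈      : p₂ ∈ A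
        toZ      : Reach (noExit v E) S₁ p₁ z
        toX      : Reach E S₂ p₂ (x , i)
        disjoint : ClDisjoint S₁ S₂

    record RightPair : Set₁ where
      field
        {S₁ S₂}  : Pred Point 0ℓ
        {q₁ q₂}  : Point
        q₁∈      : q₁ ∈ B
        q₂∈      : q₂ ∈ B
        fromZ    : Reach (noEntry v E) S₁ z q₁
        fromY    : Reach E S₂ (y , i) q₂
        disjoint : ClDisjoint S₁ S₂

    LeftAvoids : LeftPair → Set
    LeftAvoids L = ∀ {k} → ¬ LeftPair.S₂ L (v , k)

    RightAvoids : RightPair → Set
    RightAvoids R = ∀ {k} → ¬ RightPair.S₂ R (v , k)

    -- Joining a left and a right pair through `z` and through the new edge.

    module Combine (L : LeftPair) (R : RightPair) (avoids : LeftAvoids L ⊎ RightAvoids R) where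
      open LeftPair L renaming (disjoint to disjointᴸ)
      open RightPair R renaming (S₁ to S₃; S₂ to S₄; disjoint to disjointᴿ)

      O₁ O₂ O₃ O₄ : Pred Point 0ℓ
      O₁ = On toZ
      O₂ = On toX
      O₃ = On fromZ
      O₄ = On fromY

      z∉₂ : ¬ Cl O₂ z
      z∉₂ c = disjointᴸ z (cl-unit (end∈ toZ)) (cl-map (on⇒ toX) c)

      z∉₄ : ¬ Cl O₄ z
      z∉₄ c = disjointᴿ z (cl-unit (start∈ fromZ)) (cl-map (on⇒ fromY) c)

      ⊥₁₂ : ∀ {w} → Cl O₁ w → Cl O₂ w → ⊥
      ⊥₁₂ c c′ = disjointᴸ _ (cl-map (on⇒ toZ) c) (cl-map (on⇒ toX) c′)

      ⊥₃₄ : ∀ {w} → Cl O₃ w → Cl O₄ w → ⊥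
      ⊥₃₄ c c′ = disjointᴿ _ (cl-map (on⇒ fromZ) c) (cl-map (on⇒ fromY) c′)

      awayPrefix : u ≢ v → O₁ (u , a) → Reach E (Away v) p₁ (u , a)
      awayPrefix n o = map-reach noExit⊆ proj₂ (noExit⇒away n (prefix toZ o))

      awaySuffix : u ≢ v → O₃ (u , a) → Reach E (Away v) (u , a) q₁
      awaySuffix n o = map-reach noEntry⊆ proj₂ (noEntry⇒away n (suffix fromZ o))

      -- Switching at `u` from the walk into `z` to the walk out of `z` would avoid `v` altogether,
      -- hence also the cut point.
      ⊥₁₃ : u ≢ v → O₁ (u , a) → O₃ (u , b) → ⊥
      ⊥₁₃ n o o′ = cl-away (cl-map [ id , id ]′
        (glued∋z p₁∈ (awayPrefix n o) (≤-trans (on-early toZ o) (on-late fromZ o′)) (awaySuffix n o′) q₁∈))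

      -- After a switch at `u` only the part on `fromY` can visit `v`, so the cut point falls into
      -- the closure of `O₄`.
      ⊥₁₄ : u ≢ v → O₁ (u , a) → O₄ (u , b) → a ≤ b → ⊥
      ⊥₁₄ n o o′ l = z∉₄ (cl-∪ʳ (λ k → k refl) (glued∋z p₁∈ (awayPrefix n o) l (suffix fromY o′) q₂∈))

      ⊥₃₂ : u ≢ v → O₂ (u , a) → O₃ (u , b) → a ≤ b → ⊥
      ⊥₃₂ n o o′ l = z∉₂ (cl-∪ˡ (λ k → k refl) (glued∋z p₂∈ (prefix toX o) l (awaySuffix n o′) q₁∈))

      -- One of the two walks misses `v`, so the cut point of the recombined walk falls into the
      -- closure of the other one.
      ⊥₂₄ : O₂ (u , a) → O₄ (u , b) → ⊥
      ⊥₂₄ o o′ = [ (λ n → z∉₄ (cl-∪ʳ (λ o → n (on⇒ toX o)) c))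
                 , (λ n → z∉₂ (cl-∪ˡ (λ o → n (on⇒ fromY o)) c)) ]′ avoids
        where
        c = glued∋z p₂∈ (prefix toX o) (≤-trans (on-early toX o) (on-late fromY o′)) (suffix fromY o′) q₂∈

      -- A waiting interval with its two ends on different halves is excluded, so only intervals
      -- within a single half have to be compared.
      offCentre : u ≢ v → Cl (O₁ ∪ O₃) (u , a) → Cl (O₂ ∪ O₄) (u , a) → ⊥
      offCentre n (inj₁ o ⟨ _ ⟩ inj₂ o′) _ = ⊥₁₃ n o o′
      offCentre n (inj₂ o ⟨ _ ⟩ inj₁ o′) _ = ⊥₁₃ n o′ o
      offCentre n _ (inj₁ o ⟨ _ ⟩ inj₂ o′) = ⊥₂₄ o o′
      offCentre n _ (inj₂ o ⟨ _ ⟩ inj₁ o′) = ⊥₂₄ o′ o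
      offCentre n (inj₁ o ⟨ l ⟩ inj₁ o′) (inj₁ r ⟨ m ⟩ inj₁ r′) = ⊥₁₂ (o ⟨ l ⟩ o′) (r ⟨ m ⟩ r′)
      offCentre n (inj₂ o ⟨ l ⟩ inj₂ o′) (inj₂ r ⟨ m ⟩ inj₂ r′) = ⊥₃₄ (o ⟨ l ⟩ o′) (r ⟨ m ⟩ r′)
      offCentre n (inj₁ o ⟨ l , _ ⟩ inj₁ _) (inj₂ _ ⟨ _ , m ⟩ inj₂ r) = ⊥₁₄ n o r (≤-trans l m)
      offCentre n (inj₂ _ ⟨ _ , m ⟩ inj₂ o) (inj₁ r ⟨ l , _ ⟩ inj₁ _) = ⊥₃₂ n r o (≤-trans l m)

      -- `toZ` is over at time `j`, when `fromZ` starts at `v`; later times at `v` therefore belong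
      -- to `fromZ` alone.
      lateCl : j ≤ b → Cl (O₁ ∪ O₃) (v , b) → Cl O₃ (v , b)
      lateCl m (_ ⟨ _ , l ⟩ inj₁ o) = on-start fromZ ⟨ m , ≤-trans l (on-early toZ o) ⟩ on-start fromZ
      lateCl m (_ ⟨ _ , l ⟩ inj₂ o) = on-start fromZ ⟨ m , l ⟩ o

      earlyCl : b ≤ j → Cl (O₁ ∪ O₃) (v , b) → Cl O₁ (v , b)
      earlyCl m (inj₁ o ⟨ l , _ ⟩ _) = o ⟨ l , m ⟩ on-end toZ
      earlyCl m (inj₂ o ⟨ l , _ ⟩ _) = on-end toZ ⟨ ≤-trans (on-late fromZ o) l , m ⟩ on-end toZ

      -- From time `j` on this is a clash of `fromZ` with `fromY`. Before `j`, `toZ` can be left at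
      -- `v` to wait there for `fromY`, and the cut point of this walk lies in the closure of `O₄`.
      centreʳ : Cl (O₁ ∪ O₃) (v , b) → Cl O₄ (v , b) → ⊥
      centreʳ {b} c c′ with ≤-total j b
      ... | inj₁ m = ⊥₃₄ (lateCl m c) c′
      centreʳ c@(inj₂ o ⟨ l , _ ⟩ _) c′ | inj₂ _ = ⊥₃₄ (lateCl (≤-trans (on-late fromZ o) l) c) c′
      centreʳ (inj₁ o ⟨ l , _ ⟩ _) (r ⟨ m , m′ ⟩ s) | inj₂ k = z∉₄ (close
        (glued∋z p₁∈ (tighten w) (≤-trans l m′) (suffix fromY s) q₂∈))
        where
        w = map-reach noExit⊆ id (prefix toZ o)
        -- The points of `w` come before `s`, so `s` can replace a right end on `w`; `r` serves as
        -- left end because it is no later than `b`, hence than `j`.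
        close : Cl (On w ∪ O₄) z → Cl O₄ z
        close (_ ⟨ _ , h ⟩ inj₁ t) = r ⟨ ≤-trans m k , ≤-trans h (≤-trans (on-early w t) (≤-trans l m′)) ⟩ s
        close (_ ⟨ _ , h ⟩ inj₂ t) = r ⟨ ≤-trans m k , h ⟩ t

      centreˡ : Cl (O₁ ∪ O₃) (v , b) → Cl O₂ (v , b) → ⊥
      centreˡ {b} c c′ with ≤-total b j
      ... | inj₁ m = ⊥₁₂ (earlyCl m c) c′
      centreˡ c@(_ ⟨ _ , l ⟩ inj₁ o) c′ | inj₂ _ = ⊥₁₂ (earlyCl (≤-trans l (on-early toZ o)) c) c′
      centreˡ (_ ⟨ _ , l ⟩ inj₂ o) (r ⟨ m , m′ ⟩ s) | inj₂ k = z∉₂ (close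
        (glued∋z p₂∈ (prefix toX r) (≤-trans m l) (tighten w) q₁∈))
        where
        w = map-reach noEntry⊆ id (suffix fromZ o)
        close : Cl (O₂ ∪ On w) z → Cl O₂ z
        close (inj₂ t ⟨ h , _ ⟩ _) = r ⟨ ≤-trans (≤-trans m l) (≤-trans (on-late w t) h) , ≤-trans k m′ ⟩ s
        close (inj₁ t ⟨ h , _ ⟩ _) = t ⟨ h , ≤-trans k m′ ⟩ s

      combined : TwoDisjoint E⁺ A B
      combined = two
        (_ , _ , p₁∈ , q₁∈ , map-reach (there ∘ noExit⊆) inj₁ (tighten toZ)
                             ++ map-reach (there ∘ noEntry⊆) inj₂ (tighten fromZ))
        (_ , _ , p₂∈ , q₂∈ , map-reach there inj₁ (tighten toX)
                             ++ hop (inj₁ (on-end toX)) (here refl) (map-reach there inj₂ (tighten fromY)))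
        clash
        where
        clash : ClDisjoint (O₁ ∪ O₃) (O₂ ∪ O₄)
        clash (u , _) c c′ with u ≟ v
        ... | no n     = offCentre n c c′
        -- At `v` the half whose walk avoids `v` contributes nothing, which leaves one of the two
        -- clashes at the centre.
        ... | yes refl = [ (λ n → centreʳ c (cl-∪ʳ (λ o → n (on⇒ toX o)) c′))
                         , (λ n → centreˡ c (cl-∪ˡ (λ o → n (on⇒ fromY o)) c′)) ]′ avoids

    -- Finding the two pairs, or a cut for the enlarged graph.

    leftTargets rightSources : List Point
    leftTargets  = z ∷ (x , i) ∷ []
    rightSources = z ∷ (y , i) ∷ []


    -- A cut point in front of `z` and `(x , i)` remains one with the new edge: a walk through that
    -- edge begins with a walk to `(x , i)`, and every other walk can be led to `z` inside its
    -- closure.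
    weakLeft : CutOrTwo E A leftTargets → Cutᴱ⁺ ⊎ LeftPair
    weakLeft (inj₁ (w , c)) = inj₁ (w , cut⁺)
      where
      cut⁺ : Cut E⁺ A B w
      cut⁺ (p , q , p∈ , q∈ , W) with splitAtHop W
      ... | inj₂ (W₁ , _) = c (p , _ , p∈ , there (here refl) , W₁)
      ... | inj₁ W′ with toCut (p , q , p∈ , q∈ , W′)
      ...   | p′ , p′∈ , U = cl-idem (c (p′ , z , p′∈ , here refl , U))
    weakLeft (inj₂ t) with toFan t
    ... | fan a b w w′ d =
      inj₂ record { p₁∈ = a ; p₂∈ = b ; toZ = enterOnce w ; toX = w′ ; disjoint = d }

    weakRight : CutOrTwo E rightSources B → Cutᴱ⁺ ⊎ RightPair
    weakRight (inj₁ (w , c)) = inj₁ (w , cut⁺)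
      where
      cut⁺ : Cut E⁺ A B w
      cut⁺ (p , q , p∈ , q∈ , W) with splitAtHop W
      ... | inj₂ (_ , W₂) = c (_ , q , there (here refl) , q∈ , W₂)
      ... | inj₁ W′ with fromCut (p , q , p∈ , q∈ , W′)
      ...   | q′ , q′∈ , U = cl-idem (c (z , q′ , here refl , q′∈ , U))
    weakRight (inj₂ t) with toCoFan t
    ... | coFan a b w w′ d =
      inj₂ record { q₁∈ = a ; q₂∈ = b ; fromZ = exitOnce w ; fromY = w′ ; disjoint = d }

    -- Walks avoiding `v` use no edge at `v`, so the deletion is harmless here: every walk to
    -- `(x , i)`, respectively from `(y , i)`, visits `v`.
    LeftForced RightForced : Set
    LeftForced  = ∀ {p} → p ∈ A → ¬ Reach (noExit v E) (Away v) p (x , i)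
    RightForced = ∀ {q} → q ∈ B → ¬ Reach (noEntry v E) (Away v) (y , i) q

    -- Why a walk visiting v before (after) the hop does no harm: it can wait at v until z
    -- (wait at v from z on), or the hop can be bypassed.
    LeftDetour RightDetour : Set₁
    LeftDetour = ∀ {S p q a} → p ∈ A → q ∈ B →
      Reach E S p (v , a) → a ≤ i → Reach E S (y , i) q → a ≤ j ⊎ Walk E S A B
    RightDetour = ∀ {S p q b} → p ∈ A → q ∈ B →
      Reach E S p (x , i) → i ≤ b → Reach E S (v , b) q → j ≤ b ⊎ Walk E S A B

    -- Adding all points at `v` permits waiting there freely, without changing the closure at any
    -- other vertex.
    OrCentre : Pred Point 0ℓ → Pred Point 0ℓ
    OrCentre S (u , k) = S (u , k) ⊎ u ≡ v

    cl-orCentre : u ≢ v → Cl (OrCentre S) (u , a) → Cl S (u , a)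
    cl-orCentre n (inj₁ s ⟨ l ⟩ inj₁ s′) = s ⟨ l ⟩ s′
    cl-orCentre n (inj₂ e ⟨ _ ⟩ _)       = ⊥-elim (n e)
    cl-orCentre n (_ ⟨ _ ⟩ inj₂ e)       = ⊥-elim (n e)

    -- Without the edges out of `v`, the walk of a fan to `(x , i)` misses `v`. A cut point at `v`
    -- makes `v` unavoidable. A cut point elsewhere remains one with the new edge, since a walk
    -- visiting `v` before that edge is rerouted by `detour`.
    strongLeft : CutOrTwo (noExit v E) A leftTargets → LeftDetour →
      Cutᴱ⁺ ⊎ (Σ LeftPair LeftAvoids) ⊎ LeftForced
    strongLeft r detour with x ≟ v
    ... | yes refl = inj₂ (inj₂ λ _ W → end∈ W refl)
    strongLeft (inj₂ t) detour | no n with toFan t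
    ... | fan a b w w′ d = inj₂ (inj₁ (record
      { p₁∈ = a ; p₂∈ = b ; toZ = w ; toX = map-reach noExit⊆ id (noExit⇒away n w′)
      ; disjoint = λ s c c′ → d s c (cl-map proj₁ c′) } , λ s → proj₂ s refl))
    strongLeft (inj₁ ((u , k) , c)) detour | no n with u ≟ v
    ... | yes refl = inj₂ (inj₂ λ p∈ W → cl-away (c (_ , _ , p∈ , there (here refl) , W)))
    ... | no m = inj₁ ((u , k) , cut⁺)
      where
      short : Walk E S A B → Cl S (u , k)
      short W with toCut W
      ... | p , p∈ , U = cl-idem (c (p , z , p∈ , here refl , enterOnce U))
      cut⁺ : Cut E⁺ A B (u , k)
      cut⁺ (p , q , p∈ , q∈ , W) with splitAtHop W
      ... | inj₁ W′ = short (p , q , p∈ , q∈ , W′)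
      ... | inj₂ (W₁ , W₂) with firstVisit v W₁
      ...   | inj₁ U = cl-map proj₁ (c (p , _ , p∈ , there (here refl) , U))
      ...   | inj₂ (a , l , U) with detour p∈ q∈ (map-reach noExit⊆ id U) l W₂
      ...     | inj₂ W′ = short W′
      ...     | inj₁ l′ = cl-orCentre m (c (p , z , p∈ , here refl ,
                            widen inj₁ U ++ wait (inj₂ refl) l′ (done (inj₂ refl))))

    -- The time reversal of `strongLeft`.
    strongRight : CutOrTwo (noEntry v E) rightSources B → RightDetour →
      Cutᴱ⁺ ⊎ (Σ RightPair RightAvoids) ⊎ RightForced
    strongRight r detour with y ≟ v
    ... | yes refl = inj₂ (inj₂ λ _ W → start∈ W refl)
    strongRight (inj₂ t) detour | no n with toCoFan t
    ... | coFan a b w w′ d = inj₂ (inj₁ (record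
      { q₁∈ = a ; q₂∈ = b ; fromZ = w ; fromY = map-reach noEntry⊆ id (noEntry⇒away n w′)
      ; disjoint = λ s c c′ → d s c (cl-map proj₁ c′) } , λ s → proj₂ s refl))
    strongRight (inj₁ ((u , k) , c)) detour | no n with u ≟ v
    ... | yes refl = inj₂ (inj₂ λ q∈ W → cl-away (c (_ , _ , there (here refl) , q∈ , W)))
    ... | no m = inj₁ ((u , k) , cut⁺)
      where
      short : Walk E S A B → Cl S (u , k)
      short W with fromCut W
      ... | q , q∈ , U = cl-idem (c (z , q , here refl , q∈ , exitOnce U))
      cut⁺ : Cut E⁺ A B (u , k)
      cut⁺ (p , q , p∈ , q∈ , W) with splitAtHop W
      ... | inj₁ W′ = short (p , q , p∈ , q∈ , W′)
      ... | inj₂ (W₁ , W₂) with lastVisit v W₂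
      ...   | inj₁ U = cl-map proj₁ (c (_ , q , there (here refl) , q∈ , U))
      ...   | inj₂ (b , l , U) with detour p∈ q∈ W₁ l (map-reach noEntry⊆ id U)
      ...     | inj₂ W′ = short W′
      ...     | inj₁ l′ = cl-orCentre m (c (z , q , here refl , q∈ ,
                            wait (inj₂ refl) l′ (widen inj₁ U)))

    -- The walk to `(x , i)` has been at `v` by time `i`; wait there until `b` instead of taking the
    -- new edge.
    leftForced⇒bypass : LeftForced → ∀ {S p q b} → p ∈ A → q ∈ B →
      Reach E S p (x , i) → i ≤ b → Reach E S (v , b) q → Walk E S A B
    leftForced⇒bypass forced p∈ q∈ W l U with firstVisit v W
    ... | inj₁ W′           = ⊥-elim (forced p∈ (widen proj₂ W′))
    ... | inj₂ (a , m , W′) = _ , _ , p∈ , q∈ ,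
      map-reach noExit⊆ id W′ ++ wait (end∈ W′) (≤-trans m l) U

    rightForced⇒bypass : RightForced → ∀ {S p q a} → p ∈ A → q ∈ B →
      Reach E S p (v , a) → a ≤ i → Reach E S (y , i) q → Walk E S A B
    rightForced⇒bypass forced p∈ q∈ U l W with lastVisit v W
    ... | inj₁ W′           = ⊥-elim (forced q∈ (widen proj₂ W′))
    ... | inj₂ (b , m , W′) = _ , _ , p∈ , q∈ ,
      U ++ wait (end∈ U) (≤-trans l m) (map-reach noEntry⊆ id W′)

    -- A walk through the new edge is at `v` before and after it, and waiting at `v` replaces the
    -- edge.
    bothForced : LeftForced → RightForced → Cut E⁺ A B z
    bothForced left right (p , q , p∈ , q∈ , W) with splitAtHop W
    ... | inj₁ W′ = cut (p , q , p∈ , q∈ , W′)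
    ... | inj₂ (W₁ , W₂) with lastVisit v W₂
    ...   | inj₁ U           = ⊥-elim (right q∈ (widen proj₂ U))
    ...   | inj₂ (b , l , U) = cut (leftForced⇒bypass left p∈ q∈ W₁ l (map-reach noEntry⊆ id U))

    -- Only one half has to avoid `v`, so a strong pair on one side is joined with the weak pair on
    -- the other. If the first side fails because `v` is forced, that very fact supplies the detours
    -- for the second side.
    extend : (∀ E₀ A₀ B₀ → length E₀ ℕ.≤ length E → CutOrTwo E₀ A₀ B₀) → CutOrTwo E⁺ A B
    extend rec with weakLeft (rec E A leftTargets ℕₚ.≤-refl) | weakRight (rec E rightSources B ℕₚ.≤-refl)
    ... | inj₁ c | _      = inj₁ c
    ... | inj₂ _ | inj₁ c = inj₁ c
    ... | inj₂ L | inj₂ R = [ leftFirst , rightFirst ]′ (≤-total i j)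
      where
      goLeft : LeftDetour → Cutᴱ⁺ ⊎ (Σ LeftPair LeftAvoids) ⊎ LeftForced
      goLeft = strongLeft (rec (noExit v E) A leftTargets (length-noExit v E))
      goRight : RightDetour → Cutᴱ⁺ ⊎ (Σ RightPair RightAvoids) ⊎ RightForced
      goRight = strongRight (rec (noEntry v E) rightSources B (length-noEntry v E))
      leftFirst : i ≤ j → CutOrTwo E⁺ A B
      -- A visit of `v` before the hop happens by time `i`, hence early enough to wait for `z`.
      leftFirst m with goLeft (λ _ _ _ l _ → inj₁ (≤-trans l m))
      ... | inj₁ c = inj₁ c
      ... | inj₂ (inj₁ (L′ , n)) = inj₂ (Combine.combined L′ R (inj₁ n))
      ... | inj₂ (inj₂ left) with goRight (λ p∈ q∈ W l U → inj₂ (leftForced⇒bypass left p∈ q∈ W l U))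
      ...   | inj₁ c = inj₁ c
      ...   | inj₂ (inj₁ (R′ , n)) = inj₂ (Combine.combined L R′ (inj₂ n))
      ...   | inj₂ (inj₂ right) = inj₁ (z , bothForced left right)
      rightFirst : j ≤ i → CutOrTwo E⁺ A B
      rightFirst m with goRight (λ _ _ _ l _ → inj₁ (≤-trans m l))
      ... | inj₁ c = inj₁ c
      ... | inj₂ (inj₁ (R′ , n)) = inj₂ (Combine.combined L R′ (inj₂ n))
      ... | inj₂ (inj₂ right) with goLeft (λ p∈ q∈ U l W → inj₂ (rightForced⇒bypass right p∈ q∈ U l W))
      ...   | inj₁ c = inj₁ c
      ...   | inj₂ (inj₁ (L′ , n)) = inj₂ (Combine.combined L′ R (inj₁ n))
      ...   | inj₂ (inj₂ left) = inj₁ (z , bothForced left right)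

  -- The base case: Helly's theorem for time intervals.

  Span : Set
  Span = V × T × T

  Meets : Point → Span → Set
  Meets (v , k) (u , a , b) = v ≡ u × a ≤ k × k ≤ b

  -- The common intersection of a nonempty list, with spans attaining its two ends; these are needed
  -- to exhibit a disjoint pair when a further span empties it.
  record Core (L : List Span) : Set where
    field
      {centre} : V
      {latest soonest} : T
      ordered  : latest ≤ soonest
      latest∈  : ∃[ b ] (centre , latest , b) ∈ L
      soonest∈ : ∃[ a ] (centre , a , soonest) ∈ L
      covers   : ∀ {u a b} → (u , a , b) ∈ L → centre ≡ u × a ≤ latest × soonest ≤ b

  ApartPair : List Span → Set
  ApartPair L = ∃[ I ] ∃[ J ] I ∈ L × J ∈ L × (∀ x → Meets x I → Meets x J → ⊥)

  upper : ∀ a b → ∃[ m ] a ≤ m × b ≤ m × (a ≡ m ⊎ b ≡ m)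
  upper a b with ≤-total a b
  ... | inj₁ l = b , l , ≤-refl , inj₂ refl
  ... | inj₂ l = a , ≤-refl , l , inj₁ refl

  lower : ∀ a b → ∃[ m ] m ≤ a × m ≤ b × (a ≡ m ⊎ b ≡ m)
  lower a b with ≤-total a b
  ... | inj₁ l = a , ≤-refl , l , inj₁ refl
  ... | inj₂ l = b , l , ≤-refl , inj₂ refl

  -- If the largest left end `m` exceeds the smallest right end `m′`, the spans attaining them are
  -- disjoint.
  insertSpan : ∀ {u c d L} → c ≤ d → Core L → Core ((u , c , d) ∷ L) ⊎ ApartPair ((u , c , d) ∷ L)
  insertSpan {u} {c} {d} {L} c≤d K with Core.centre K ≟ u | upper (Core.latest K) c | lower (Core.soonest K) d
  ... | no n | _ | _ =
    inj₂ (_ , _ , here refl , there (proj₂ (Core.latest∈ K)) , λ { _ (e , _) (e′ , _) → n (trans (sym e′) e) })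
  ... | yes refl | m , l≤m , c≤m , m∈ | m′ , m′≤s , m′≤d , m′∈ with m ≤? m′
  ...   | yes l = inj₁ record
    { ordered = l ; latest∈ = latestSpan m∈ ; soonest∈ = soonestSpan m′∈
    ; covers  = λ { (here refl) → refl , c≤m , m′≤d
                  ; (there h) → let (e , f , g) = Core.covers K h in e , ≤-trans f l≤m , ≤-trans m′≤s g } }
    where
    latestSpan : Core.latest K ≡ m ⊎ c ≡ m → ∃[ b ] (u , m , b) ∈ (u , c , d) ∷ L
    latestSpan (inj₁ refl) = _ , there (proj₂ (Core.latest∈ K))
    latestSpan (inj₂ refl) = _ , here refl
    soonestSpan : Core.soonest K ≡ m′ ⊎ d ≡ m′ → ∃[ a ] (u , a , m′) ∈ (u , c , d) ∷ L
    soonestSpan (inj₁ refl) = _ , there (proj₂ (Core.soonest∈ K))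
    soonestSpan (inj₂ refl) = _ , here refl
  ...   | no n = inj₂ (apart m∈ m′∈)
    where
    apart : Core.latest K ≡ m ⊎ c ≡ m → Core.soonest K ≡ m′ ⊎ d ≡ m′ → ApartPair ((u , c , d) ∷ L)
    apart (inj₁ refl) (inj₁ refl) = contradiction (Core.ordered K) n
    apart (inj₂ refl) (inj₂ refl) = contradiction c≤d n
    apart (inj₁ refl) (inj₂ refl) = _ , _ , here refl , there (proj₂ (Core.latest∈ K)) ,
      λ { _ (_ , _ , l) (_ , l′ , _) → n (≤-trans l′ l) }
    apart (inj₂ refl) (inj₁ refl) = _ , _ , here refl , there (proj₂ (Core.soonest∈ K)) ,
      λ { _ (_ , l , _) (_ , _ , l′) → n (≤-trans l l′) }

  Ordered : Span → Set
  Ordered (_ , a , b) = a ≤ b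

  helly : Point → ∀ L → (∀ {I} → I ∈ L → Ordered I) →
    (∃[ z ] ∀ {I} → I ∈ L → Meets z I) ⊎ ApartPair L
  helly d L ord = finish L (core L ord)
    where
    core : ∀ L → (∀ {I} → I ∈ L → Ordered I) → (L ≡ [] ⊎ Core L) ⊎ ApartPair L
    core [] _ = inj₁ (inj₁ refl)
    core ((u , a , b) ∷ L) ord with core L (ord ∘ there)
    ... | inj₁ (inj₁ refl) = inj₁ (inj₂ record
      { ordered = ord (here refl) ; latest∈ = _ , here refl ; soonest∈ = _ , here refl
      ; covers = λ { (here refl) → refl , ≤-refl , ≤-refl } })
    ... | inj₂ (I , J , I∈ , J∈ , n) = inj₂ (I , J , there I∈ , there J∈ , n)
    ... | inj₁ (inj₂ K) with insertSpan (ord (here refl)) K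
    ...   | inj₁ K′ = inj₁ (inj₂ K′)
    ...   | inj₂ P  = inj₂ P
    finish : ∀ L → (L ≡ [] ⊎ Core L) ⊎ ApartPair L → (∃[ z ] ∀ {I} → I ∈ L → Meets z I) ⊎ ApartPair L
    finish L (inj₂ P)         = inj₂ P
    -- No span imposes a condition, so the default point serves.
    finish L (inj₁ (inj₁ refl)) = inj₁ (d , λ ())
    finish L (inj₁ (inj₂ K)) = inj₁ ((centre , latest) , λ h →
      let (e , l , m) = covers h in e , l , ≤-trans ordered m)
      where open Core K

  Waits : Point × Point → Set
  Waits ((u , a) , (w , b)) = u ≡ w × a ≤ b

  waits? : ∀ I → Dec (Waits I)
  waits? ((u , a) , (w , b)) = (u ≟ w) ×-dec (a ≤? b)

  hopless : Reach [] S p q → Waits (p , q)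
  hopless (done _)     = refl , ≤-refl
  hopless (wait _ l w) = let (e , m) = hopless w in e , ≤-trans l m

  span : Point × Point → Span
  span ((u , a) , (_ , b)) = u , a , b

  waitWalk : ∀ {I} → I ∈ cartesianProduct A B → Waits I → Walk [] (λ x → Meets x (span I)) A B
  waitWalk {A} {B} h (refl , l) with ∈-cartesianProduct⁻ A B h
  ... | p∈ , q∈ = _ , _ , p∈ , q∈ ,
    wait (refl , ≤-refl , l) l (done (refl , l , ≤-refl))

  cl-meets : ∀ {I x} → Cl (λ x → Meets x I) x → Meets x I
  cl-meets ((e , l , _) ⟨ m , m′ ⟩ (_ , _ , l′)) = e , ≤-trans l m , ≤-trans m′ l′

  -- Without edges a walk only waits at one vertex, and the dichotomy becomes Helly's theorem for
  -- the spans of the waiting pairs.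
  hoplessMenger : Point → ∀ A B → CutOrTwo [] A B
  hoplessMenger d A B with helly d (map span waiting) ordered
    where
    waiting : List (Point × Point)
    waiting = filter waits? (cartesianProduct A B)
    ordered : ∀ {I} → I ∈ map span waiting → Ordered I
    ordered h with ∈-map⁻ span h
    ... | _ , h′ , refl = proj₂ (proj₂ (∈-filter⁻ waits? {xs = cartesianProduct A B} h′))
  ... | inj₁ (z , meets) = inj₁ (z , cut)
    where
    cut : Cut [] A B z
    cut (p , q , p∈ , q∈ , w) with hopless w
    ... | refl , l with meets (∈-map⁺ span (∈-filter⁺ waits? (∈-cartesianProduct⁺ p∈ q∈) (refl , l)))
    ...   | refl , l′ , m = start∈ w ⟨ l′ , m ⟩ end∈ w
  ... | inj₂ (I , J , I∈ , J∈ , n) with ∈-map⁻ span I∈ | ∈-map⁻ span J∈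
  ...   | _ , h , refl | _ , h′ , refl
    with ∈-filter⁻ waits? {xs = cartesianProduct A B} h | ∈-filter⁻ waits? {xs = cartesianProduct A B} h′
  ...     | g , w | g′ , w′ =
    inj₂ (two (waitWalk g w) (waitWalk g′ w′) λ x c c′ → n x (cl-meets c) (cl-meets c′))

  -- The induction on the number of edges, and decidability of reachability.

  menger : Point → ∀ E A B → CutOrTwo E A B
  menger d E A B = bounded (length E) E A B ℕₚ.≤-refl
    where
    -- The bound `n` admits the filtered edge lists, which are not structural parts of `E`; `A` and
    -- `B` vary because the step changes them.
    bounded : ∀ n E A B → length E ℕ.≤ n → CutOrTwo E A B
    bounded n       []               A B _       = hoplessMenger d A B
    bounded (suc n) ((x , y , i) ∷ E) A B (s≤s l) with bounded n E A B l
    ... | inj₁ ((v , j) , cut) = Step.extend E A B v j x y i cut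
      λ E₀ A₀ B₀ l₀ → bounded n E₀ A₀ B₀ (ℕₚ.≤-trans l₀ l)
    ... | inj₂ (two (_ , _ , p∈ , q∈ , w) (_ , _ , p∈′ , q∈′ , w′) d) = inj₂ (two
      (_ , _ , p∈ , q∈ , map-reach there id w) (_ , _ , p∈′ , q∈′ , map-reach there id w′) d)

  walk? : ∀ E A B → Dec (Walk E U A B)
  walk? [] A B = map′ toWalk
    (λ { (_ , _ , p∈ , q∈ , w) → lose (∈-cartesianProduct⁺ p∈ q∈) (hopless w) })
    (any? waits? (cartesianProduct A B))
    where
    toWalk : Any Waits (cartesianProduct A B) → Walk [] U A B
    toWalk h with find h
    ... | I , I∈ , w with waitWalk I∈ w
    ...   | _ , _ , p∈ , q∈ , W = _ , _ , p∈ , q∈ , widen _ W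
  walk? ((x , y , i) ∷ E) A B = map′
    [ (λ { (_ , _ , p∈ , q∈ , w) → _ , _ , p∈ , q∈ , map-reach there id w })
    , (λ { ((_ , _ , p∈ , here refl , w) , (_ , _ , here refl , q∈ , w′)) →
             _ , _ , p∈ , q∈ , map-reach there id w ++ hop _ (here refl) (map-reach there id w′) }) ]′
    (λ { (_ , _ , p∈ , q∈ , w) → [ (λ w′ → inj₁ (_ , _ , p∈ , q∈ , w′))
       , (λ { (w₁ , w₂) → inj₂ ((_ , _ , p∈ , here refl , w₁) , (_ , _ , here refl , q∈ , w₂)) }) ]′
       (splitAtHop w) })
    (walk? E A B ⊎-dec (walk? E A ((x , i) ∷ []) ×-dec walk? E ((y , i) ∷ []) B))

-- Translation between temporal paths and walks.

lo≤hi : ∀ {l m} (f : Fin (suc l) → Fin m) → (∀ i j → i F.≤ j → f i F.≤ f j) → ∀ k → lo f k F.≤ hi f k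
lo≤hi f mono zero = Fₚ.≤-refl
lo≤hi {zero} f mono (suc zero) = Fₚ.≤-refl
lo≤hi {suc l} f mono (suc zero) = mono zero (suc zero) z≤n
lo≤hi {suc l} f mono (suc (suc k)) = lo≤hi {l} (f ∘ suc) (λ i j h → mono (suc i) (suc j) (s≤s h)) (suc k)

module TemporalMenger (G : TGraph) (s t : Fin (n G)) (s≢t : s ≢ t) (nonAdj : NonAdjacent G s t) where

  open Menger (Fₚ._≟_ {n G}) (F._≤_ {τ G}) Fₚ.≤-refl Fₚ.≤-trans Fₚ.≤-total Fₚ._≤?_

  Inner : Pred Point 0ℓ
  Inner (u , _) = u ≢ s × u ≢ t

  -- Edges into `s` or `t` are left out, so a walk that starts at an inner vertex never meets the
  -- terminals.
  IsHop : Pred Hop 0ℓ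
  IsHop (u , v , i) = adj G u v ≡ true × lam G u v i ≡ true × v ≢ s × v ≢ t

  isHop? : Decidable IsHop
  isHop? (u , v , i) =
    (adj G u v 𝔹.≟ true) ×-dec (lam G u v i 𝔹.≟ true) ×-dec ¬? (v Fₚ.≟ s) ×-dec ¬? (v Fₚ.≟ t)

  -- The first and last arcs of a path become end conditions: an arrival from `s`, and a departure
  -- to `t`.
  IsSource IsSink : Pred Point 0ℓ
  IsSource (v , i) = adj G s v ≡ true × lam G s v i ≡ true
  IsSink   (v , i) = adj G v t ≡ true × lam G v t i ≡ true

  isSource? : Decidable IsSource
  isSource? (v , i) = (adj G s v 𝔹.≟ true) ×-dec (lam G s v i 𝔹.≟ true)

  isSink? : Decidable IsSink
  isSink? (v , i) = (adj G v t 𝔹.≟ true) ×-dec (lam G v t i 𝔹.≟ true)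

  points : List Point
  points = cartesianProduct (allFin (n G)) (allFin (τ G))

  allHops : List Hop
  allHops = cartesianProduct (allFin (n G)) points

  ∈-points : ∀ x → x ∈ points
  ∈-points (v , i) = ∈-cartesianProduct⁺ (∈-allFin v) (∈-allFin i)

  hops : List Hop
  hops = filter isHop? allHops

  sources sinks : List Point
  sources = filter isSource? points
  sinks   = filter isSink? points

  hop⁺ : ∀ {h} → IsHop h → h ∈ hops
  hop⁺ {u , p} = ∈-filter⁺ isHop? (∈-cartesianProduct⁺ (∈-allFin u) (∈-points p))

  hop⁻ : ∀ {h} → h ∈ hops → IsHop h
  hop⁻ h∈ = proj₂ (∈-filter⁻ isHop? {xs = allHops} h∈)

  stayInner : ∀ {S p q} → Inner p → Reach hops S p q → Reach hops (S ∩ Inner) p q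
  stayInner m (done x)     = done (x , m)
  stayInner m (wait x l w) = wait (x , m) l (stayInner m w)
  stayInner m (hop x e w)  = hop (x , m) e (stayInner (proj₂ (proj₂ (hop⁻ e))) w)

  private
    variable
      v w : Fin (n G)
      a b : Fin (τ G)

  firstTime : TPath G v t → Fin (τ G)
  firstTime P = time P zero

  prepend : (P : TPath G w t) → adj G v w ≡ true → lam G v w b ≡ true → b F.≤ firstTime P →
    (∀ k → vert P k ≢ v) → TPath G v t
  prepend {w} {v} {b} P adj≡ lam≡ b≤ fresh = record
    { ℓ        = suc (ℓ P)
    ; vert     = λ { zero → v ; (suc k) → vert P k }
    ; time     = λ { zero → b ; (suc k) → time P k }
    ; start    = refl
    ; end      = end P
    ; distinct = λ { {zero} {zero} _ → refl
                   ; {zero} {suc k} e → contradiction (sym e) (fresh k)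
                   ; {suc k} {zero} e → contradiction e (fresh k)
                   ; {suc k} {suc l} e → cong suc (distinct P e) }
    ; arc      = λ { zero → subst (λ x → adj G v x ≡ true) (sym (start P)) adj≡ ; (suc k) → arc P k }
    ; avail    = λ { zero → subst (λ x → lam G v x b ≡ true) (sym (start P)) lam≡ ; (suc k) → avail P k }
    ; mono     = λ { zero zero _ → Fₚ.≤-refl
                   ; zero (suc k) _ → Fₚ.≤-trans b≤ (mono P zero k z≤n)
                   ; (suc k) (suc l) (s≤s m) → mono P k l m }
    }

  -- Besides the new start, only `w` gains points: it is now occupied from the arrival at time `b`
  -- until its departure.
  InVT-prepend : ∀ (P : TPath G w t) (e : adj G v w ≡ true) (e′ : lam G v w b ≡ true)
    (l : b F.≤ firstTime P) (f : ∀ k → vert P k ≢ v) {u k} → InVT (u , k) (prepend P e e′ l f) →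
    (u ≡ v × b F.≤ k × k F.≤ b) ⊎ (u ≡ w × b F.≤ k × k F.≤ firstTime P) ⊎ InVT (u , k) P
  InVT-prepend P _ _ _ _ (zero , refl , m , m′)        = inj₁ (refl , m , m′)
  InVT-prepend P _ _ _ _ (suc zero , refl , m , m′)    = inj₂ (inj₁ (start P , m , m′))
  InVT-prepend P _ _ _ _ (suc (suc i) , refl , m , m′) = inj₂ (inj₂ (suc i , refl , m , m′))

  single : adj G v t ≡ true → lam G v t b ≡ true → v ≢ t → TPath G v t
  single {v} {b} adj≡ lam≡ v≢t = record
    { ℓ = 0
    ; vert     = λ { zero → v ; (suc _) → t }
    ; time     = λ _ → b
    ; start    = refl
    ; end      = refl
    ; distinct = λ { {zero} {zero} _ → refl
                   ; {zero} {suc zero} e → contradiction e v≢t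
                   ; {suc zero} {zero} e → contradiction (sym e) v≢t
                   ; {suc zero} {suc zero} _ → refl }
    ; arc      = λ { zero → adj≡ }
    ; avail    = λ { zero → lam≡ }
    ; mono     = λ _ _ _ → Fₚ.≤-refl
    }

  tail : ∀ {l} (P : TPath G v t) → ℓ P ≡ suc l → TPath G (vert P (suc zero)) t
  tail P@record { ℓ = suc l ; vert = vert ; time = time } refl = record
    { ℓ        = l
    ; vert     = vert ∘ suc
    ; time     = time ∘ suc
    ; start    = refl
    ; end      = end P
    ; distinct = Fₚ.suc-injective ∘ distinct P
    ; arc      = arc P ∘ suc
    ; avail    = avail P ∘ suc
    ; mono     = λ i j m → mono P (suc i) (suc j) (s≤s m)
    }

  tail-late : ∀ {l} (P : TPath G v t) (e : ℓ P ≡ suc l) → firstTime P F.≤ firstTime (tail P e)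
  tail-late P@record { ℓ = suc _ } refl = mono P zero (suc zero) z≤n

  InVT-tail : ∀ {l} (P : TPath G v t) (e : ℓ P ≡ suc l) {u k} → InVT (u , k) (tail P e) → InVT (u , k) P
  InVT-tail P@record { ℓ = suc _ } refl (zero , e , m , m′)  = suc zero , e , Fₚ.≤-trans (tail-late P refl) m , m′
  InVT-tail P@record { ℓ = suc _ } refl (suc k , e , m , m′) = suc (suc k) , e , m , m′

  dropTo : (P : TPath G v t) → ∀ k → vert P k ≢ t →
    Σ (TPath G (vert P k) t) λ Q → firstTime P F.≤ firstTime Q × (∀ {u k} → InVT (u , k) Q → InVT (u , k) P)
  dropTo P zero _ = record { TPath P ; start = refl } , Fₚ.≤-refl , id
  dropTo P@record { ℓ = zero } (suc zero) ≢t = contradiction (end P) ≢t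
  dropTo P@record { ℓ = suc l } (suc k) ≢t with dropTo (tail P refl) k ≢t
  ... | Q , le , sub = Q , Fₚ.≤-trans (tail-late P refl) le , InVT-tail P refl ∘ sub

  -- The path may depart later than `a`. The wait at its start is not among its temporal vertices
  -- and is accounted for only when an arc is prepended.
  record Erasure (S : Pred Point 0ℓ) (v : Fin (n G)) (a : Fin (τ G)) : Set where
    field
      path  : TPath G v t
      late  : a F.≤ firstTime path
      stays : ∀ {u k} → InVT (u , k) path → u ≢ t → Cl S (u , k)

  startsIn : (P : TPath G v t) → InVT (v , firstTime P) P
  startsIn P = zero , start P , Fₚ.≤-refl , Fₚ.≤-refl

  erase : ∀ {S v a q} → q ∈ sinks → Reach hops (S ∩ Inner) (v , a) q → Erasure S v a
  erase {S} q∈ (done {v , a} (x , _ , v≢t)) = record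
    { path  = single adj≡ lam≡ v≢t
    ; late  = Fₚ.≤-refl
    ; stays = λ { (zero , refl , m , m′) _ → x ⟨ m , m′ ⟩ x ; (suc zero , e , _) ≢t → contradiction (sym e) ≢t }
    }
    where
    adj≡ = proj₁ (proj₂ (∈-filter⁻ isSink? {xs = points} q∈))
    lam≡ = proj₂ (proj₂ (∈-filter⁻ isSink? {xs = points} q∈))
  erase q∈ (wait x l w) = record { path = path ; late = Fₚ.≤-trans l late ; stays = stays }
    where open Erasure (erase q∈ w)
  erase {S} q∈ (hop {v} {y} {a} (x , v≢s , v≢t) e w) with erase q∈ w
  ... | record { path = P ; late = late ; stays = stays } with Fₚ.any? (λ k → vert P k Fₚ.≟ v)
  -- The path returns to `v`: cut off the loop and wait at `v` instead.
  ...   | yes (k , refl) with dropTo P k v≢t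
  ...     | Q , le , sub = record
    { path = Q ; late = Fₚ.≤-trans late le ; stays = λ h → stays (sub h) }
  erase {S} q∈ (hop {v} {y} {a} (x , v≢s , v≢t) e w) | record { path = P ; late = late ; stays = stays }
        | no fresh = record
    { path  = prepend P (proj₁ (hop⁻ e)) (proj₁ (proj₂ (hop⁻ e))) late (λ k eq → fresh (k , eq))
    ; late  = Fₚ.≤-refl
    ; stays = λ h → split (InVT-prepend P (proj₁ (hop⁻ e)) (proj₁ (proj₂ (hop⁻ e))) late (λ k eq → fresh (k , eq)) h)
    }
    where
    split : ∀ {u k} → (u ≡ v × a F.≤ k × k F.≤ a) ⊎ (u ≡ y × a F.≤ k × k F.≤ firstTime P) ⊎ InVT (u , k) P →
      u ≢ t → Cl S (u , k)
    split (inj₁ (refl , m , m′)) _ = x ⟨ m , m′ ⟩ x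
    -- Arrival and departure at `y` both lie in the closure, hence so does the wait between them.
    split (inj₂ (inj₁ (refl , m , m′))) ≢t with stays (startsIn P) ≢t
    ... | _ ⟨ _ , l ⟩ x′ = proj₁ (start∈ w) ⟨ m , Fₚ.≤-trans m′ l ⟩ x′
    split (inj₂ (inj₂ h)) ≢t = stays h ≢t

  cl-inner : ∀ {S x} → Cl (S ∩ Inner) x → Inner x
  cl-inner ((_ , m) ⟨ _ ⟩ _) = m

  walk⇒path : ∀ {S} → Walk hops S sources sinks →
    Σ (TPath G s t) λ P → ∀ {u k} → InVT (u , k) P → u ≡ s ⊎ u ≡ t ⊎ Cl S (u , k)
  walk⇒path {S} ((v , a) , q , p∈ , q∈ , w) = path′ , stays′
    where
    adj≡ = proj₁ (proj₂ (∈-filter⁻ isSource? {xs = points} p∈))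
    lam≡ = proj₂ (proj₂ (∈-filter⁻ isSource? {xs = points} p∈))
    inner : Inner (v , a)
    inner = (λ { refl → 𝔹.not-¬ (noLoop G s) adj≡ }) , (λ { refl → 𝔹.not-¬ (proj₁ nonAdj) adj≡ })
    -- Keeping `Inner` in the predicate shows that the path avoids `s`, so that `s` can be
    -- prepended.
    open Erasure (erase {S = S ∩ Inner} q∈ (widen (λ x → x , proj₂ x) (stayInner inner w)))
    fresh : ∀ k → vert path k ≢ s
    fresh k e = proj₁ (cl-inner (stays (k , e , Fₚ.≤-refl , lo≤hi (time path) (mono path) k) s≢t)) refl
    path′ : TPath G s t
    path′ = prepend path adj≡ lam≡ late fresh
    stays′ : ∀ {u k} → InVT (u , k) path′ → u ≡ s ⊎ u ≡ t ⊎ Cl S (u , k)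
    stays′ {u} h with InVT-prepend path adj≡ lam≡ late fresh h
    ... | inj₁ (e , _) = inj₁ e
    ... | inj₂ r with u Fₚ.≟ t
    ...   | yes e = inj₂ (inj₁ e)
    stays′ h | inj₂ (inj₂ i) | no ≢t = inj₂ (inj₂ (cl-map proj₁ (stays i ≢t)))
    stays′ h | inj₂ (inj₁ (refl , m , m′)) | no ≢t with stays (startsIn path) ≢t
    ... | _ ⟨ _ , l ⟩ x′ = inj₂ (inj₂ (start∈ w ⟨ m , Fₚ.≤-trans m′ l ⟩ proj₁ x′))

  next≢end : ∀ {l} (P : TPath G v t) → ℓ P ≡ suc l → vert P (suc zero) ≢ t
  next≢end P@record { ℓ = suc _ } refl e with distinct P (trans e (sym (end P)))
  ... | ()

  noReturn : (P : TPath G v t) → ∀ k → vert P (suc k) ≢ v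
  noReturn P k e with distinct P (trans e (sym (start P)))
  ... | ()

  followPath : ∀ {S} l (P : TPath G v t) → ℓ P ≡ l → (∀ {u k} → InVT (u , k) P → u ≢ t → S (u , k)) →
    v ≢ t → (∀ k → vert P (suc k) ≢ s) → S (v , a) → a F.≤ firstTime P →
    ∃[ q ] q ∈ sinks × Reach hops S (v , a) q
  followPath zero P@record { start = refl ; end = refl } refl sub v≢t _ x l =
    (_ , firstTime P) , ∈-filter⁺ isSink? (∈-points _) (arc P zero , avail P zero) ,
    wait x l (done (sub (startsIn P) v≢t))
  followPath (suc l) P@record { start = refl } refl sub v≢t ≢s x le
    with followPath l (tail P refl) refl (λ h → sub (InVT-tail P refl h)) (next≢end P refl) (≢s ∘ suc)
           (sub (suc zero , refl , Fₚ.≤-refl , tail-late P refl) (next≢end P refl)) (tail-late P refl)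
  ... | q , q∈ , W =
    q , q∈ , wait x le (hop (sub (startsIn P) v≢t) (hop⁺ (arc P zero , avail P zero , ≢s zero , (next≢end P refl))) W)

  InnerOf : TPath G s t → Pred Point 0ℓ
  InnerOf P (u , k) = InVT (u , k) P × Inner (u , k)

  path⇒walk : (P : TPath G s t) → Walk hops (InnerOf P) sources sinks
  path⇒walk P@record { ℓ = zero ; start = refl ; end = refl } =
    contradiction (arc P zero) (𝔹.not-¬ (proj₁ nonAdj))
  path⇒walk P@record { ℓ = suc l ; start = refl } with followPath l (tail P refl) refl
      (λ { h@(k , e , _) ≢t → InVT-tail P refl h , (λ e′ → noReturn P k (trans e e′)) , ≢t })
      (next≢end P refl) (λ k → noReturn P (suc k))
      ((suc zero , refl , Fₚ.≤-refl , tail-late P refl) , noReturn P zero , next≢end P refl)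
      (tail-late P refl)
  ... | q , q∈ , W = _ , q , ∈-filter⁺ isSource? (∈-points _) (arc P zero , avail P zero) , q∈ , W

  -- A path visits each vertex only once, during one interval of time, so the closure adds no point.
  cl-InVT : (P : TPath G s t) → ∀ {x} → Cl (InnerOf P) x → InVT x P × Inner x
  cl-InVT P {u , k} (((i , e , m , _) , inner) ⟨ l , l′ ⟩ ((i′ , e′ , _ , m′) , _)) with distinct P (trans e (sym e′))
  ... | refl = (i , e , Fₚ.≤-trans m l , Fₚ.≤-trans l′ m′) , inner

  innerOf : (P : TPath G s t) → ∃[ x ] InVT x P × Inner x
  innerOf P with path⇒walk P
  ... | _ , _ , _ , _ , w = _ , start∈ w

  uncut : ¬ TPath G s t → IsTCut G s t []
  uncut none = [] , (λ _ _ ()) , λ P → contradiction P none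

  -- The equivalence of part (1).

  tp1⇒tpc1 : TP≡ G s t 1 → TPC≡ G s t 1
  tp1⇒tpc1 ((P , _) , max) with menger (proj₁ (innerOf (P zero))) hops sources sinks
  ... | inj₁ (z , cut) = (z ∷ [] , ([] ∷ [] , inner , hit) , refl) , minimal
    where
    inner : ∀ v j → (v , j) ∈ z ∷ [] → v ≢ s × v ≢ t
    inner v j (here refl) = proj₂ (cl-InVT (P zero) (cut (path⇒walk (P zero))))
    hit : ∀ Q → ∃[ x ] (x ∈ z ∷ [] × InVT x Q)
    hit Q = z , here refl , proj₁ (cl-InVT Q (cut (path⇒walk Q)))
    minimal : ∀ S → IsTCut G s t S → 1 ℕ.≤ length S
    minimal []      (_ , _ , hits) with hits (P zero)
    ... | _ , () , _
    minimal (_ ∷ _) _ = s≤s z≤n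
  ... | inj₂ (two w₁ w₂ d) with walk⇒path w₁ | walk⇒path w₂
  ...   | P₁ , stays₁ | P₂ , stays₂ = contradiction (max 2 pair disjoint) λ { (s≤s ()) }
    where
    pair : Fin 2 → TPath G s t
    pair zero    = P₁
    pair (suc _) = P₂
    clash : TDisjoint P₁ P₂
    clash v j h h′ with stays₁ h | stays₂ h′
    ... | inj₁ e | _ = inj₁ e
    ... | inj₂ (inj₁ e) | _ = inj₂ e
    ... | inj₂ (inj₂ c) | inj₁ e = inj₁ e
    ... | inj₂ (inj₂ c) | inj₂ (inj₁ e) = inj₂ e
    ... | inj₂ (inj₂ c) | inj₂ (inj₂ c′) = ⊥-elim (d (v , j) c c′)
    disjoint : DisjointFamily G s t 2 pair
    disjoint zero       zero       ne = contradiction refl ne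
    disjoint zero       (suc zero) _  = clash
    disjoint (suc zero) zero       _  = λ v j h h′ → clash v j h′ h
    disjoint (suc zero) (suc zero) ne = contradiction refl ne

  path? : Dec (TPath G s t)
  path? = map′ (proj₁ ∘ walk⇒path) path⇒Uwalk (walk? hops sources sinks)
    where
    path⇒Uwalk : TPath G s t → Walk hops U sources sinks
    path⇒Uwalk P with path⇒walk P
    ... | _ , _ , p∈ , q∈ , w = _ , _ , p∈ , q∈ , widen _ w

  -- Any two paths meet in the cut point, which is at neither terminal.
  tpc1⇒tp1 : TPC≡ G s t 1 → TP≡ G s t 1
  tpc1⇒tp1 ((z ∷ [] , (_ , inner , hits) , refl) , minimal) with path?
  -- Without a path the empty set would be a smaller cut.
  ... | no none = contradiction (minimal [] (uncut none)) λ ()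
  ... | yes P   = ((λ _ → P) , λ { zero zero ne → contradiction refl ne }) , atMostOne
    where
    throughZ : ∀ Q → InVT z Q
    throughZ Q with hits Q
    ... | _ , here refl , h = h
    atMostOne : ∀ m (Q : Fin m → TPath G s t) → DisjointFamily G s t m Q → m ℕ.≤ 1
    atMostOne zero          _ _ = z≤n
    atMostOne (suc zero)    _ _ = s≤s z≤n
    atMostOne (suc (suc m)) Q d with d zero (suc zero) (λ ()) _ _ (throughZ (Q zero)) (throughZ (Q (suc zero)))
    ... | inj₁ e = contradiction e (proj₁ (inner _ _ (here refl)))
    ... | inj₂ e = contradiction e (proj₂ (inner _ _ (here refl)))

-- Every path of the gadget contains (v , 1), or two of (u , 1), (u , 3), (x , 1); this splits the
-- paths into two classes of pairwise intersecting ones.  On the other hand viaU, viaUXV and viaVXU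
-- have no common point, and viaV avoids all three of them.
module Gadget where

  -- The gadget, its labels and four routes through it.

  Code : Set
  Code = Fin 5

  pattern s = 0F
  pattern t = 1F
  pattern v = 2F
  pattern x = 3F
  pattern u = 4F

  halfEdge : Code → Code → Bool
  halfEdge s v = true
  halfEdge s u = true
  halfEdge v t = true
  halfEdge u t = true
  halfEdge v x = true
  halfEdge x u = true
  halfEdge _ _ = false

  -- Vectors rather than functions, because Undirected asks for equal label functions.
  halfLabels : Code → Code → Vec Bool 4
  halfLabels s v = true  ∷ true  ∷ false ∷ false ∷ []
  halfLabels s u = false ∷ true  ∷ false ∷ false ∷ []
  halfLabels v t = false ∷ true  ∷ true  ∷ false ∷ []
  halfLabels u t = false ∷ false ∷ false ∷ true  ∷ []
  halfLabels v x = true  ∷ false ∷ true  ∷ false ∷ []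
  halfLabels x u = false ∷ true  ∷ false ∷ true  ∷ []
  halfLabels _ _ = replicate 4 false

  edge : Code → Code → Bool
  edge a b = halfEdge a b ∨ halfEdge b a

  labels : Code → Code → Vec Bool 4
  labels a b = zipWith _∨_ (halfLabels a b) (halfLabels b a)

  label : Code → Code → Fin 4 → Bool
  label a b = lookup (labels a b)

  edge-irrefl : ∀ a → edge a a ≡ false
  edge-irrefl = from-yes (Fₚ.all? λ a → edge a a 𝔹.≟ false)

  -- This and the next three tables, checked by evaluation, drive the case analysis of `classify`.
  labelsFrom-s : ∀ b i → label s b i ≡ true → (b ≡ u × i ≡ 1F) ⊎ b ≡ v × (i ≡ 0F ⊎ i ≡ 1F)
  labelsFrom-s = from-yes (Fₚ.all? λ b → Fₚ.all? λ i → (label s b i 𝔹.≟ true) →-dec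
    ((b Fₚ.≟ u ×-dec i Fₚ.≟ 1F) ⊎-dec b Fₚ.≟ v ×-dec (i Fₚ.≟ 0F ⊎-dec i Fₚ.≟ 1F)))

  labelsFrom-u : ∀ b i → label u b i ≡ true → b ≡ s ⊎ i ≡ 3F ⊎ (b ≡ x × i ≡ 1F)
  labelsFrom-u = from-yes (Fₚ.all? λ b → Fₚ.all? λ i → (label u b i 𝔹.≟ true) →-dec
    (b Fₚ.≟ s ⊎-dec i Fₚ.≟ 3F ⊎-dec (b Fₚ.≟ x ×-dec i Fₚ.≟ 1F)))

  labelsFrom-v : ∀ b i → label v b i ≡ true → b ≡ s ⊎ 1 ℕ.≤ F.toℕ i ⊎ (b ≡ x × i ≡ 0F)
  labelsFrom-v = from-yes (Fₚ.all? λ b → Fₚ.all? λ i → (label v b i 𝔹.≟ true) →-dec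
    (b Fₚ.≟ s ⊎-dec 1 ℕₚ.≤? F.toℕ i ⊎-dec (b Fₚ.≟ x ×-dec i Fₚ.≟ 0F)))

  labelsFrom-x : ∀ b i → label x b i ≡ true → b ≡ v ⊎ (b ≡ u × (i ≡ 1F ⊎ i ≡ 3F))
  labelsFrom-x = from-yes (Fₚ.all? λ b → Fₚ.all? λ i → (label x b i 𝔹.≟ true) →-dec
    (b Fₚ.≟ v ⊎-dec (b Fₚ.≟ u ×-dec (i Fₚ.≟ 1F ⊎-dec i Fₚ.≟ 3F))))

  Inner : Code → Set
  Inner a = a ≢ s × a ≢ t

  inner? : ∀ a → Dec (Inner a)
  inner? a = ¬? (a Fₚ.≟ s) ×-dec ¬? (a Fₚ.≟ t)

  record IsRoute {ℓ} (code : Fin (suc (suc ℓ)) → Code) (clock : Fin (suc ℓ) → Fin 4) : Set where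
    field
      start    : code zero ≡ s
      end      : code (fromℕ (suc ℓ)) ≡ t
      distinct : ∀ i j → code i ≡ code j → i ≡ j
      arc      : ∀ i → edge (code (inject₁ i)) (code (suc i)) ≡ true
      avail    : ∀ i → label (code (inject₁ i)) (code (suc i)) (clock i) ≡ true
      mono     : ∀ i j → i F.≤ j → clock i F.≤ clock j

  isRoute? : ∀ {ℓ} code clock → Dec (IsRoute {ℓ} code clock)
  isRoute? {ℓ} code clock = map′
    (λ { (a , b , c , d , e , f) → record { start = a ; end = b ; distinct = c ; arc = d ; avail = e ; mono = f } })
    (λ { record { start = a ; end = b ; distinct = c ; arc = d ; avail = e ; mono = f } → a , b , c , d , e , f })
    (code zero Fₚ.≟ s
      ×-dec code (fromℕ (suc ℓ)) Fₚ.≟ t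
      ×-dec (Fₚ.all? λ i → Fₚ.all? λ j → code i Fₚ.≟ code j →-dec i Fₚ.≟ j)
      ×-dec (Fₚ.all? λ i → edge (code (inject₁ i)) (code (suc i)) 𝔹.≟ true)
      ×-dec (Fₚ.all? λ i → label (code (inject₁ i)) (code (suc i)) (clock i) 𝔹.≟ true)
      ×-dec (Fₚ.all? λ i → Fₚ.all? λ j → i Fₚ.≤? j →-dec clock i Fₚ.≤? clock j))

  record Route : Set where
    field
      {ℓ}     : ℕ
      code    : Fin (suc (suc ℓ)) → Code
      clock   : Fin (suc ℓ) → Fin 4
      isRoute : IsRoute code clock
    open IsRoute isRoute public

  open Route

  Local : Set
  Local = Code × Fin 4

  _≟ᴸ_ : (p q : Local) → Dec (p ≡ q)
  _≟ᴸ_ = ×-≡-dec Fₚ._≟_ Fₚ._≟_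

  _On_ : Local → Route → Set
  (a , j) On R = ∃[ i ] code R i ≡ a × lo (clock R) i F.≤ j × j F.≤ hi (clock R) i

  _on?_ : ∀ p R → Dec (p On R)
  (a , j) on? R = Fₚ.any? λ i → code R i Fₚ.≟ a ×-dec lo (clock R) i Fₚ.≤? j ×-dec j Fₚ.≤? hi (clock R) i

  route : ∀ {ℓ} (codes : Vec Code (suc (suc ℓ))) (clocks : Vec (Fin 4) (suc ℓ))
    {_ : True (isRoute? (lookup codes) (lookup clocks))} → Route
  route codes clocks {r} = record { code = lookup codes ; clock = lookup clocks ; isRoute = toWitness r }

  viaV viaU viaUXV viaVXU : Route
  viaV   = route (s ∷ v ∷ t ∷ []) (1F ∷ 1F ∷ [])
  viaU   = route (s ∷ u ∷ t ∷ []) (1F ∷ 3F ∷ [])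
  viaUXV = route (s ∷ u ∷ x ∷ v ∷ t ∷ []) (1F ∷ 1F ∷ 2F ∷ 2F ∷ [])
  viaVXU = route (s ∷ v ∷ x ∷ u ∷ t ∷ []) (0F ∷ 0F ∷ 3F ∷ 3F ∷ [])

  Misses : Route → Route → Set
  Misses R R′ = ∀ a j → Inner a → (a , j) On R → ¬ (a , j) On R′

  misses? : ∀ R R′ → Dec (Misses R R′)
  misses? R R′ = Fₚ.all? λ a → Fₚ.all? λ j → inner? a →-dec ((a , j) on? R →-dec ¬? ((a , j) on? R′))

  viaV-misses-viaU : Misses viaV viaU
  viaV-misses-viaU = from-yes (misses? viaV viaU)

  viaV-misses-viaUXV : Misses viaV viaUXV
  viaV-misses-viaUXV = from-yes (misses? viaV viaUXV)

  viaV-misses-viaVXU : Misses viaV viaVXU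
  viaV-misses-viaVXU = from-yes (misses? viaV viaVXU)

  noCommonPoint : ∀ a j → Inner a → (a , j) On viaU → (a , j) On viaUXV → ¬ (a , j) On viaVXU
  noCommonPoint = from-yes (Fₚ.all? λ a → Fₚ.all? λ j → inner? a →-dec
    ((a , j) on? viaU →-dec ((a , j) on? viaUXV →-dec ¬? ((a , j) on? viaVXU))))

  record Three (S : Local → Set) : Set where
    field
      point    : Fin 3 → Local
      inner    : ∀ r → Inner (proj₁ (point r))
      chosen   : ∀ r → S (point r)
      distinct : ∀ r r′ → point r ≡ point r′ → r ≡ r′

  -- The point on `viaV` differs from those on the other routes. If `viaU` and `viaUXV` are hit in
  -- the same point, `viaVXU` must be hit in another one, as the three have none in common.
  three : ∀ {S} → (∀ p → S p → Inner (proj₁ p)) →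
    (∀ R → ∃[ p ] S p × p On R) → Three S
  three {S} inner hit with hit viaV | hit viaU | hit viaUXV | hit viaVXU
  ... | p , p∈ , h | q , q∈ , g | r , r∈ , f | r′ , r′∈ , f′ = choose (q ≟ᴸ r)
    where
    build : ∀ a b c → S a → S b → S c → a ≢ b → a ≢ c → b ≢ c → Three S
    build a b c a∈ b∈ c∈ ab ac bc = record
      { point    = λ { 0F → a ; 1F → b ; 2F → c }
      ; inner    = λ { 0F → inner a a∈ ; 1F → inner b b∈ ; 2F → inner c c∈ }
      ; chosen   = λ { 0F → a∈ ; 1F → b∈ ; 2F → c∈ }
      ; distinct = λ { 0F 0F _ → refl ; 1F 1F _ → refl ; 2F 2F _ → refl
                     ; 0F 1F e → contradiction e ab ; 1F 0F e → contradiction (sym e) ab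
                     ; 0F 2F e → contradiction e ac ; 2F 0F e → contradiction (sym e) ac
                     ; 1F 2F e → contradiction e bc ; 2F 1F e → contradiction (sym e) bc } }
    p≢q : p ≢ q
    p≢q refl = viaV-misses-viaU _ _ (inner p p∈) h g
    choose : Dec (q ≡ r) → Three S
    choose (no q≢r) = build p q r p∈ q∈ r∈ p≢q (λ { refl → viaV-misses-viaUXV _ _ (inner p p∈) h f }) q≢r
    choose (yes refl) = build p q r′ p∈ q∈ r′∈ p≢q (λ { refl → viaV-misses-viaVXU _ _ (inner p p∈) h f′ })
      (λ { refl → noCommonPoint _ _ (inner q q∈) g f f′ })

-- Copies of the gadget glued at `s` and `t`.

module Glued (k : ℕ) where

  open Gadget

  Vertex : Set
  Vertex = Fin (suc (suc (k * 3)))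

  copyOf : Fin (k * 3) → Fin k
  copyOf = quotient 3

  slotOf : Fin (k * 3) → Fin 3
  slotOf = remainder {k} 3

  copyOf-combine : ∀ c r → copyOf (combine c r) ≡ c
  copyOf-combine c r = cong proj₁ (Fₚ.remQuot-combine c r)

  code : Vertex → Code
  code zero          = s
  code (suc zero)    = t
  code (suc (suc w)) = suc (suc (slotOf w))

  sameCopy : Vertex → Vertex → Bool
  sameCopy (suc (suc w)) (suc (suc w′)) = does (copyOf w Fₚ.≟ copyOf w′)
  sameCopy _             _              = true

  embed : Fin k → Code → Vertex
  embed c zero          = zero
  embed c (suc zero)    = suc zero
  embed c (suc (suc r)) = suc (suc (combine c r))

  code-embed : ∀ c a → code (embed c a) ≡ a
  code-embed c zero          = refl
  code-embed c (suc zero)    = refl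
  code-embed c (suc (suc r)) = cong (λ p → suc (suc (proj₂ p))) (Fₚ.remQuot-combine c r)

  sameCopy-embed : ∀ c a b → sameCopy (embed c a) (embed c b) ≡ true
  sameCopy-embed c zero          b             = refl
  sameCopy-embed c (suc zero)    b             = refl
  sameCopy-embed c (suc (suc _)) zero          = refl
  sameCopy-embed c (suc (suc _)) (suc zero)    = refl
  sameCopy-embed c (suc (suc r)) (suc (suc r′)) = dec-true (_ Fₚ.≟ _)
    (trans (copyOf-combine c r) (sym (copyOf-combine c r′)))

  sameCopy-sym : ∀ w w′ → sameCopy w w′ ≡ sameCopy w′ w
  sameCopy-sym zero          zero           = refl
  sameCopy-sym zero          (suc zero)     = refl
  sameCopy-sym zero          (suc (suc _))  = refl
  sameCopy-sym (suc zero)    zero           = refl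
  sameCopy-sym (suc zero)    (suc zero)     = refl
  sameCopy-sym (suc zero)    (suc (suc _))  = refl
  sameCopy-sym (suc (suc _)) zero           = refl
  sameCopy-sym (suc (suc _)) (suc zero)     = refl
  sameCopy-sym (suc (suc w)) (suc (suc w′)) with copyOf w Fₚ.≟ copyOf w′ | copyOf w′ Fₚ.≟ copyOf w
  ... | yes _ | yes _ = refl
  ... | no _  | no _  = refl
  ... | yes e | no n  = contradiction (sym e) n
  ... | no n  | yes e = contradiction (sym e) n

  -- The terminals are shared by all copies, so `a` has to be inner.
  embed-injective : ∀ {c c′ a b} → Inner a → embed c a ≡ embed c′ b → c ≡ c′ × a ≡ b
  embed-injective {a = zero}        (≢s , _) _ = contradiction refl ≢s
  embed-injective {a = suc zero}    (_ , ≢t) _ = contradiction refl ≢t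
  embed-injective {c} {c′} {suc (suc r)} {suc (suc r′)} _ e =
    let (c≡ , r≡) = Fₚ.combine-injective c r c′ r′ (Fₚ.suc-injective (Fₚ.suc-injective e))
    in c≡ , cong (λ r → suc (suc r)) r≡

  code-injective : ∀ {c a b} → embed c a ≡ embed c b → a ≡ b
  code-injective {c} e = trans (sym (code-embed c _)) (trans (cong code e) (code-embed c _))

  graph : TGraph
  graph = record
    { n      = suc (suc (k * 3))
    ; τ      = 4
    ; adj    = λ w w′ → edge (code w) (code w′) ∧ sameCopy w w′
    ; noLoop = λ w → cong (_∧ sameCopy w w) (edge-irrefl (code w))
    ; lam    = λ w w′ → label (code w) (code w′)
    }

  source target : Vertex
  source = zero
  target = suc zero

  undirected : Undirected graph
  undirected = (λ w w′ → cong₂ _∧_ (𝔹.∨-comm (halfEdge (code w) (code w′)) _) (sameCopy-sym w w′))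
             , (λ w w′ → cong lookup (zipWith-comm 𝔹.∨-comm (halfLabels (code w) (code w′)) _))

  embedded : ∀ w → w ≡ source ⊎ w ≡ target ⊎ (∃[ c ] ∃[ r ] w ≡ embed c (suc (suc r)))
  embedded zero          = inj₁ refl
  embedded (suc zero)    = inj₂ (inj₁ refl)
  embedded (suc (suc w)) = inj₂ (inj₂ (copyOf w , remainder {k} 3 w ,
    cong (λ w → suc (suc w)) (sym (Fₚ.combine-remQuot {k} 3 w))))

  adj-source : ∀ {w} → adj graph source w ≡ true → ∃[ c ] ∃[ b ] w ≡ embed c b
  adj-source {w} e with embedded w
  ... | inj₂ (inj₂ (c , r , refl)) = c , suc (suc r) , refl
  adj-source () | inj₁ refl
  adj-source () | inj₂ (inj₁ refl)

  adj-embed : ∀ {c a w} → Inner a → adj graph (embed c a) w ≡ true → ∃[ b ] w ≡ embed c b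
  adj-embed {w = w} _ e with embedded w
  ... | inj₁ refl        = s , refl
  ... | inj₂ (inj₁ refl) = t , refl
  adj-embed {a = zero}     (≢s , _) _ | inj₂ (inj₂ _) = contradiction refl ≢s
  adj-embed {a = suc zero} (_ , ≢t) _ | inj₂ (inj₂ _) = contradiction refl ≢t
  adj-embed {c} {suc (suc r′)} _ e    | inj₂ (inj₂ (c′ , r , refl)) =
    suc (suc r) , cong (λ c → embed c (suc (suc r)))
      (trans (sym (copyOf-combine c′ r)) (trans (sym copies≡) (copyOf-combine c r′)))
    where
    copies≡ : copyOf (combine c r′) ≡ copyOf (combine c′ r)
    copies≡ with copyOf (combine c r′) Fₚ.≟ copyOf (combine c′ r)
               | 𝔹.∧-conicalʳ (edge (code (embed c (suc (suc r′)))) (code (embed c′ (suc (suc r))))) _ e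
    ... | yes q | _ = q

  Path : Set
  Path = TPath graph source target

  Through : Path → Fin k → Local → Set
  Through P c (a , j) = InVT (embed c a , j) P

  -- The two classes of paths in a copy, and the upper bound on `tp`.

  data Kind (P : Path) (c : Fin k) : Fin 2 → Set where
    via-v : Through P c (v , 1F) → Kind P c 0F
    via-u : Through P c (u , 1F) → Through P c (u , 3F) → Kind P c 1F
    via-ux : Through P c (u , 1F) → Through P c (x , 1F) → Kind P c 1F
    via-xu : Through P c (x , 1F) → Through P c (u , 3F) → Kind P c 1F

  Shared : Path → Path → Set
  Shared P Q = ∃[ c ] ∃[ p ] Inner (proj₁ p) × Through P c p × Through Q c p

  innerV : Inner v
  innerV = (λ ()) , λ ()

  innerX : Inner x
  innerX = (λ ()) , λ ()

  innerU : Inner u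
  innerU = (λ ()) , λ ()

  -- Class 0 has a fixed common point; in class 1, two pairs chosen from three points always
  -- overlap.
  sameKind⇒shared : ∀ {P Q c κ} → Kind P c κ → Kind Q c κ → Shared P Q
  sameKind⇒shared (via-v h)    (via-v h′)    = _ , _ , innerV , h , h′
  sameKind⇒shared (via-u h _)  (via-u h′ _)  = _ , _ , innerU , h , h′
  sameKind⇒shared (via-u h _)  (via-ux h′ _) = _ , _ , innerU , h , h′
  sameKind⇒shared (via-u _ h)  (via-xu _ h′) = _ , _ , innerU , h , h′
  sameKind⇒shared (via-ux h _) (via-u h′ _)  = _ , _ , innerU , h , h′
  sameKind⇒shared (via-ux h _) (via-ux h′ _) = _ , _ , innerU , h , h′
  sameKind⇒shared (via-ux _ h) (via-xu h′ _) = _ , _ , innerX , h , h′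
  sameKind⇒shared (via-xu _ h) (via-u _ h′)  = _ , _ , innerU , h , h′
  sameKind⇒shared (via-xu h _) (via-ux _ h′) = _ , _ , innerX , h , h′
  sameKind⇒shared (via-xu h _) (via-xu h′ _) = _ , _ , innerX , h , h′

  codeStep : ∀ {c a b w w′ i} → w ≡ embed c a → w′ ≡ embed c b → lam graph w w′ i ≡ true → label a b i ≡ true
  codeStep {c} {a} {b} {i = i} refl refl e = subst₂ (λ a b → label a b i ≡ true) (code-embed c a) (code-embed c b) e

  advance : ∀ (P : Path) i {c a} → vert P (inject₁ i) ≡ embed c a → Inner a →
    ∃[ b ] vert P (suc i) ≡ embed c b × label a b (time P i) ≡ true
  advance P i e inner with adj-embed inner (subst (λ w → adj graph w _ ≡ true) e (arc P i))
  ... | b , e′ = b , e′ , codeStep e e′ (avail P i)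

  notSource : ∀ (P : Path) i → vert P (suc i) ≢ source
  notSource P i e with distinct P (trans e (sym (start P)))
  ... | ()

  Classified : Path → Set
  Classified P = ∃[ c ] ∃[ κ ] Kind P c κ

  startAtU : ∀ P {l c} → ℓ P ≡ suc l → vert P 1F ≡ embed c u → time P 0F ≡ 1F → Classified P
  startAtU P@record { ℓ = suc l } {c = c} refl e t₀ with advance P 1F e innerU
  ... | b , e′ , lab with labelsFrom-u b (time P 1F) lab
  ...   | inj₁ refl = contradiction e′ (notSource P 1F)
  ...   | inj₂ (inj₁ t₁) = c , 1F , via-u
    (1F , e , Fₚ.≤-reflexive t₀ , Fₚ.≤-trans (Fₚ.≤-reflexive (sym t₀)) (mono P 0F 1F z≤n))
    (1F , e , Fₚ.≤-trans (Fₚ.≤-reflexive t₀) (s≤s z≤n) , Fₚ.≤-reflexive (sym t₁))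
  ...   | inj₂ (inj₂ (refl , t₁)) = c , 1F , via-ux
    (1F , e , Fₚ.≤-reflexive t₀ , Fₚ.≤-reflexive (sym t₁))
    (2F , e′ , Fₚ.≤-reflexive t₁ , Fₚ.≤-trans (Fₚ.≤-reflexive (sym t₁)) (lo≤hi (time P) (mono P) 2F))

  -- A path that reaches `v` at time 0 either is still there at time 1 or moves at once to `x`, from
  -- where it can only go on to `u`, at time 1 or 3.
  startAtV : ∀ P {l c} → ℓ P ≡ suc l → vert P 1F ≡ embed c v → time P 0F ≡ 0F → Classified P
  startAtV P@record { ℓ = suc l } {c = c} refl e t₀ with advance P 1F e innerV
  ... | b , e′ , lab with labelsFrom-v b (time P 1F) lab
  ...   | inj₁ refl = contradiction e′ (notSource P 1F)
  ...   | inj₂ (inj₁ m) = c , 0F , via-v (1F , e , Fₚ.≤-trans (Fₚ.≤-reflexive t₀) z≤n , m)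
  startAtV P@record { ℓ = suc zero } refl e t₀ | b , e′ , lab | inj₂ (inj₂ (refl , t₁)) =
    contradiction (trans (sym e′) (end P)) λ ()
  startAtV P@record { ℓ = suc (suc l) } {c = c} refl e t₀ | b , e′ , lab | inj₂ (inj₂ (refl , t₁))
    with advance P 2F e′ innerX
  ... | b′ , e″ , lab′ with labelsFrom-x b′ (time P 2F) lab′
  ...   | inj₁ refl = contradiction (distinct P (trans e″ (sym e))) λ ()
  ...   | inj₂ (refl , inj₁ t₂) = c , 1F , via-ux
    (3F , e″ , Fₚ.≤-reflexive t₂ , Fₚ.≤-trans (Fₚ.≤-reflexive (sym t₂)) (lo≤hi (time P) (mono P) 3F))
    (2F , e′ , Fₚ.≤-trans (Fₚ.≤-reflexive t₁) z≤n , Fₚ.≤-reflexive (sym t₂))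
  ...   | inj₂ (refl , inj₂ t₂) = c , 1F , via-xu
    (2F , e′ , Fₚ.≤-trans (Fₚ.≤-reflexive t₁) z≤n , Fₚ.≤-trans (s≤s z≤n) (Fₚ.≤-reflexive (sym t₂)))
    (3F , e″ , Fₚ.≤-reflexive t₂ , Fₚ.≤-trans (Fₚ.≤-reflexive (sym t₂)) (lo≤hi (time P) (mono P) 3F))

  classify : ∀ P → Classified P
  classify P@record { ℓ = zero }
    with subst₂ (λ w w′ → adj graph w w′ ≡ true) (start P) (end P) (arc P 0F)
  ... | ()
  classify P@record { ℓ = suc l } with adj-source (subst (λ w → adj graph w (vert P 1F) ≡ true) (start P) (arc P 0F))
  ... | c , b , e with labelsFrom-s b (time P 0F) (codeStep {c} {s} (start P) e (avail P 0F))
  ...   | inj₁ (refl , t₀)        = startAtU P refl e t₀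
  ...   | inj₂ (refl , inj₁ t₀)   = startAtV P refl e t₀
  ...   | inj₂ (refl , inj₂ t₀)   = c , 0F , via-v
    (1F , e , Fₚ.≤-reflexive t₀ , Fₚ.≤-trans (Fₚ.≤-reflexive (sym t₀)) (mono P 0F 1F z≤n))

  embed-terminal : ∀ {c a} → embed c a ≡ source ⊎ embed c a ≡ target → ¬ Inner a
  embed-terminal {a = zero}        _         (≢s , _) = ≢s refl
  embed-terminal {a = suc zero}    _         (_ , ≢t) = ≢t refl
  embed-terminal {a = suc (suc _)} (inj₁ ()) _
  embed-terminal {a = suc (suc _)} (inj₂ ()) _

  -- Pigeonhole: paths with the same copy and the same class share an inner point.
  atMost : ∀ m (P : Fin m → Path) → DisjointFamily graph source target m P → m ℕ.≤ k * 2
  atMost m P disjoint = Fₚ.injective⇒≤ {f = kind} injective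
    where
    kind : Fin m → Fin (k * 2)
    kind i = let (c , κ , _) = classify (P i) in combine c κ
    injective : Injective _≡_ _≡_ kind
    injective {i} {i′} e with i Fₚ.≟ i′ | classify (P i) | classify (P i′)
    ... | yes i≡ | _ | _ = i≡
    ... | no i≢ | c , κ , h | c′ , κ′ , h′ with Fₚ.combine-injective c κ c′ κ′ e
    ...   | refl , refl with sameKind⇒shared h h′
    ...     | d , (a , j) , inner , g , g′ = contradiction inner (embed-terminal (disjoint i i′ i≢ _ j g g′))

  -- Routes followed inside a copy; a maximum disjoint family.

  follow : Fin k → Route → Path
  follow c R = record
    { ℓ        = Route.ℓ R
    ; vert     = embed c ∘ Route.code R
    ; time     = Route.clock R
    ; start    = cong (embed c) (Route.start R)
    ; end      = cong (embed c) (Route.end R)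
    ; distinct = Route.distinct R _ _ ∘ code-injective
    ; arc      = λ i → adj⁺ (Route.code R (inject₁ i)) (Route.code R (suc i)) (Route.arc R i)
    ; avail    = λ i → lam⁺ (Route.code R (inject₁ i)) (Route.code R (suc i)) (Route.clock R i) (Route.avail R i)
    ; mono     = Route.mono R
    }
    where
    adj⁺ : ∀ a b → edge a b ≡ true → adj graph (embed c a) (embed c b) ≡ true
    adj⁺ a b e = cong₂ _∧_ (trans (cong₂ edge (code-embed c a) (code-embed c b)) e) (sameCopy-embed c a b)
    lam⁺ : ∀ a b i → label a b i ≡ true → lam graph (embed c a) (embed c b) i ≡ true
    lam⁺ a b i e = trans (cong₂ (λ a b → label a b i) (code-embed c a) (code-embed c b)) e

  terminal? : ∀ a → Inner a ⊎ (∀ c → embed c a ≡ source ⊎ embed c a ≡ target)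
  terminal? zero          = inj₂ λ _ → inj₁ refl
  terminal? (suc zero)    = inj₂ λ _ → inj₂ refl
  terminal? (suc (suc _)) = inj₁ ((λ ()) , λ ())

  follow-disjoint : ∀ {c c′ R R′} → c ≢ c′ ⊎ Misses R R′ → TDisjoint (follow c R) (follow c′ R′)
  follow-disjoint {c} {c′} {R} apart w j (i , refl , m) (i′ , e , m′) with terminal? (Route.code R i)
  ... | inj₂ h = h c
  ... | inj₁ inner with embed-injective inner (sym e)
  ...   | c≡ , a≡ with apart
  ...     | inj₁ c≢     = contradiction c≡ c≢
  ...     | inj₂ misses = contradiction (i′ , sym a≡ , m′) (misses _ j inner (i , refl , m))

  routeOf : Fin 2 → Route
  routeOf zero    = viaV
  routeOf (suc _) = viaU

  family : Fin (k * 2) → Path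
  family i = let (c , κ) = remQuot 2 i in follow c (routeOf κ)

  family-disjoint : DisjointFamily graph source target (k * 2) family
  family-disjoint i i′ i≢ = go (remQuot 2 i) (remQuot 2 i′) λ e →
      i≢ (trans (sym (Fₚ.combine-remQuot {k} 2 i))
        (trans (cong (λ p → combine (proj₁ p) (proj₂ p)) e) (Fₚ.combine-remQuot {k} 2 i′)))
    where
    go : ∀ p p′ → p ≢ p′ → TDisjoint (follow (proj₁ p) (routeOf (proj₂ p))) (follow (proj₁ p′) (routeOf (proj₂ p′)))
    go (c , 0F) (c′ , 1F) ne = follow-disjoint {R = viaV} {viaU} (inj₂ viaV-misses-viaU)
    go (c , 1F) (c′ , 0F) ne = follow-disjoint {R = viaU} {viaV} (inj₂ λ a j n h h′ → viaV-misses-viaU a j n h′ h)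
    go (c , 0F) (c′ , 0F) ne = follow-disjoint {R = viaV} {viaV} (inj₁ λ { refl → ne refl })
    go (c , 1F) (c′ , 1F) ne = follow-disjoint {R = viaU} {viaU} (inj₁ λ { refl → ne refl })

  tp : TP≡ graph source target (k * 2)
  tp = (family , family-disjoint) , atMost

  -- The minimum size of a cut.

  -- The first point meets class 0; any two of the three points defining class 1 meet every path of
  -- that class.
  cutPoint : Fin 3 → Local
  cutPoint 0F = v , 1F
  cutPoint 1F = u , 1F
  cutPoint 2F = u , 3F

  cutPoint-inner : ∀ r → Inner (proj₁ (cutPoint r))
  cutPoint-inner 0F = innerV
  cutPoint-inner 1F = innerU
  cutPoint-inner 2F = innerU

  cutPoint-injective : ∀ r r′ → cutPoint r ≡ cutPoint r′ → r ≡ r′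
  cutPoint-injective = from-yes (Fₚ.all? λ r → Fₚ.all? λ r′ → cutPoint r ≟ᴸ cutPoint r′ →-dec r Fₚ.≟ r′)

  place : (Fin k → Fin 3 → Local) → Fin (k * 3) → TVertex graph
  place f i = let c = copyOf i ; (a , j) = f c (slotOf i) in embed c a , j

  place-injective : ∀ f → (∀ c r → Inner (proj₁ (f c r))) → (∀ c r r′ → f c r ≡ f c r′ → r ≡ r′) →
    Injective _≡_ _≡_ (place f)
  place-injective f inner inj {i} {i′} e with ,-injective e
  ... | e₁ , e₂ with embed-injective (inner (copyOf i) (slotOf i)) e₁
  ...   | c≡ , a≡ = trans (sym (Fₚ.combine-remQuot {k} 3 i))
    (trans (cong₂ combine c≡ r≡) (Fₚ.combine-remQuot {k} 3 i′))
    where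
    r≡ : slotOf i ≡ slotOf i′
    r≡ = inj (copyOf i) _ _ (trans (cong₂ _,_ a≡ e₂) (cong (λ c → f c (slotOf i′)) (sym c≡)))

  cutList : List (TVertex graph)
  cutList = tabulate (place λ _ → cutPoint)

  ∈-cutList : ∀ c r → (embed c (proj₁ (cutPoint r)) , proj₂ (cutPoint r)) ∈ cutList
  ∈-cutList c r = subst (_∈ cutList)
    (cong₂ (λ c r → embed c (proj₁ (cutPoint r)) , proj₂ (cutPoint r))
      (copyOf-combine c r) (cong proj₂ (Fₚ.remQuot-combine c r)))
    (∈-tabulate⁺ {f = place λ _ → cutPoint} (combine c r))

  cutList-isCut : IsTCut graph source target cutList
  cutList-isCut = tabulate⁺ (place-injective (λ _ → cutPoint) (λ _ → cutPoint-inner) (λ _ → cutPoint-injective))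
    , inner , hits
    where
    inner : ∀ w j → (w , j) ∈ cutList → w ≢ source × w ≢ target
    inner w j h with ∈-tabulate⁻ {f = place λ _ → cutPoint} h
    ... | i , refl = (λ e → embed-terminal (inj₁ e) (cutPoint-inner (slotOf i)))
                   , (λ e → embed-terminal (inj₂ e) (cutPoint-inner (slotOf i)))
    hits : ∀ P → ∃[ p ] (p ∈ cutList × InVT p P)
    hits P with classify P
    ... | c , _ , via-v h    = _ , ∈-cutList c 0F , h
    ... | c , _ , via-u h _  = _ , ∈-cutList c 1F , h
    ... | c , _ , via-ux h _ = _ , ∈-cutList c 1F , h
    ... | c , _ , via-xu _ h = _ , ∈-cutList c 2F , h

  -- The routes force three cut points in each copy. Inner points of different copies differ, so
  -- their positions in `S` are pairwise distinct.
  cut-size : ∀ S → IsTCut graph source target S → k * 3 ℕ.≤ length S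
  cut-size S (_ , inner , hits) = Fₚ.injective⇒≤ {f = position} injective
    where
    Chosen : Fin k → Local → Set
    Chosen c (a , j) = (embed c a , j) ∈ S
    chosenInner : ∀ c p → Chosen c p → Inner (proj₁ p)
    chosenInner c (a , j) h with terminal? a
    ... | inj₁ i = i
    ... | inj₂ f = ⊥-elim ([ proj₁ (inner _ j h) , proj₂ (inner _ j h) ]′ (f c))
    hitRoute : ∀ c R → ∃[ p ] Chosen c p × p On R
    hitRoute c R with hits (follow c R)
    ... | (_ , j) , h , (i , refl , m) = (Route.code R i , j) , h , (i , refl , m)
    triple : ∀ c → Three (Chosen c)
    triple c = three (chosenInner c) (hitRoute c)
    pick : Fin k → Fin 3 → Local
    pick c = Three.point (triple c)
    picked : ∀ i → place pick i ∈ S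
    picked i = Three.chosen (triple (copyOf i)) (slotOf i)
    position : Fin (k * 3) → Fin (length S)
    position i = index (picked i)
    injective : Injective _≡_ _≡_ position
    injective {i} {i′} e = place-injective pick (λ c → Three.inner (triple c)) (λ c → Three.distinct (triple c))
      (trans (lookup-index (picked i)) (trans (cong (L.lookup S) e) (sym (lookup-index (picked i′)))))

  tpc : TPC≡ graph source target (k + k * 2)
  -- The size `k * 3` is rewritten as `k` more than the value `k * 2` of `tp`.
  tpc = subst (TPC≡ graph source target) (ℕₚ.*-suc k 2)
    ((cutList , cutList-isCut , length-tabulate _) , cut-size)

theorem1 : ((G : TGraph) (s t : Fin (n G)) → s ≢ t → NonAdjacent G s t →
    TP≡ G s t 1 ⇔ TPC≡ G s t 1)
    ×
    (∀ k → 2 ≤ k →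
    (∃[ G ] ∃[ s ] ∃[ t ] (Undirected G × s ≢ t × NonAdjacent G s t
    × ∃[ p ] (TP≡ G s t p × TPC≡ G s t (k + p))))
    ×
    (∃[ G ] ∃[ s ] ∃[ t ] (s ≢ t × NonAdjacent G s t
    × ∃[ p ] (TP≡ G s t p × TPC≡ G s t (k + p)))))
theorem1 =
  (λ G s t s≢t nonAdj → let open TemporalMenger G s t s≢t nonAdj in mk⇔ tp1⇒tpc1 tpc1⇒tp1) ,
  λ k _ → let open Glued k in
    (graph , source , target , undirected , (λ ()) , (refl , refl) , k * 2 , tp , tpc) ,
    -- Read as a directed graph with both arcs for every edge, the same graph serves again.
    (graph , source , target , (λ ()) , (refl , refl) , k * 2 , tp , tpc)
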